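{- Let $n\ge 2$, let $N,i,j,k_1,\dots,k_n$ be positive integers with $\gcd(N,i,j,k_1,\dots,k_n)=1$ and $N\nmid i+j+k_1+\cdots+k_n$. Let $p\equiv 1\pmod N$ be a prime, let $\lambda_1,\dots,\lambda_n\in\mathbb{F}_p$ be distinct and different from $0$ and $1$, and let $\eta_N\in\widehat{\mathbb{F}_p^\times}$ be a primitive character of order $N$ (exact order $N$). Let $C_{\lambda}^{[N;i,j,\mathbf{k}]}$ be the generalized Picard curve $$y^N=x^i(1-x)^j(1-\lambda_1x)^{k_1}\cdots(1-\lambda_nx)^{k_n}.$$ Then $$\#C_{\lambda}^{[N;i,j,\mathbf{k}]}(\mathbb{F}_p)=1+p+\sum_{m=1}^{N-1}\mathbb{P}_D^{(n)}\left[\begin{matrix}\eta_N^{mi}; & \eta_N^{ -mk_1}\ \cdots\ \eta_N^{ -mk_n}\\ & \eta_N^{mi+mj}\end{matrix};\,\lambda_1,\dots,\lambda_n\right].$$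
   Context: $\#C_{\lambda}^{[N;i,j,\mathbf{k}]}(\mathbb{F}_p)$ denotes the number of $\mathbb{F}_p$-points of the (singular) curve, i.e. the number of affine solutions $(x,y)\in\mathbb{F}_p^2$ of the equation plus $1$ for the single point at infinity. $\widehat{\mathbb{F}_p^\times}$ is the group of complex-valued multiplicative characters of $\mathbb{F}_p^\times$; every character $\chi$, including the trivial one, is extended to $\mathbb{F}_p$ by $\chi(0)=0$, and $\overline{\chi}=\chi^{ -1}$. For $A,C,B_1,\dots,B_n\in\widehat{\mathbb{F}_p^\times}$ and $\lambda_1,\dots,\lambda_n\in\mathbb{F}_p$, the finite-field Appell-Lauricella period function is $$\mathbb{P}_D^{(n)}\left[\begin{matrix}A; & B_1\ \cdots\ B_n\\ & C\end{matrix};\lambda_1,\dots,\lambda_n\right]=\sum_{y\in\mathbb{F}_p}A(y)\,C\overline{A}(1-y)\,\overline{B_1}(1-\lambda_1y)\cdots\overline{B_n}(1-\lambda_ny).$$ -}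

module Defs where

open import Algebra.Bundles using (AbelianGroup; CommutativeRing; Group; Semiring)
open import Algebra.Consequences.Setoid using (comm∧idˡ⇒id; comm∧invˡ⇒inv; comm∧distrˡ⇒distr)
open import Algebra.Core using (Op₁; Op₂)
open import Algebra.Definitions
import Algebra.Definitions.RawMonoid as RawMonoidDefs
import Algebra.Definitions.RawSemiring as RawSemiringDefs
open import Algebra.Morphism.Bundles using (GroupHomomorphism)
import Algebra.Properties.AbelianGroup as AbelianGroupProperties
import Algebra.Properties.CommutativeSemigroup as CommutativeSemigroupProperties
import Algebra.Properties.Ring as RingProperties
import Algebra.Solver.Ring.NaturalCoefficients.Default as SemiringSolver
open import Data.Fin.Base using (Fin; toℕ)
import Data.Fin.Properties as Fin
open import Data.List.Base using (allFin; cartesianProduct; filter; length)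
open import Data.Nat.Base as ℕ using (ℕ; suc; NonZero; _∸_)
open import Data.Nat.Coprimality using (prime⇒coprime; coprime-Bézout)
open import Data.Nat.DivMod
open import Data.Nat.GCD using (module Bézout)
open import Data.Nat.Primality using (Prime; prime⇒nonZero)
import Data.Nat.Properties as ℕ
open import Data.Product.Base using (∃; _×_; _,_; proj₁; proj₂)
open import Data.Rational.Base as Rat using (ℚ; 0ℚ; 1ℚ; ½; ∣_∣; _<_)
import Data.Rational.Properties as Rat
open import Data.Rational.Solver using (module +-*-Solver)
open import Data.Vec.Functional using (Vector)
open import Level using (0ℓ; _⊔_)
open import Relation.Binary.Core using (Rel)
import Relation.Binary.PropositionalEquality as ≡
open import Relation.Binary.PropositionalEquality using (_≡_; _≢_)
open import Relation.Binary.Structures using (IsEquivalence)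
open import Relation.Nullary using (¬_; Dec; yes; no)
open import Relation.Unary using (Decidable)

------------------------------------------------------------------------
-- Commutative rings

mkCommutativeRing :
  ∀ {c ℓ} {A : Set c} {_≈_ : Rel A ℓ} {_+_ _*_ : Op₂ A} { -_ : Op₁ A} (0# 1# : A) →
  IsEquivalence _≈_ →
  Congruent₂ _≈_ _+_ → Congruent₁ _≈_ -_ → Congruent₂ _≈_ _*_ →
  Associative _≈_ _+_ → Commutative _≈_ _+_ → LeftIdentity _≈_ 0# _+_ →
  LeftInverse _≈_ 0# -_ _+_ →
  Associative _≈_ _*_ → Commutative _≈_ _*_ → LeftIdentity _≈_ 1# _*_ →
  _DistributesOverˡ_ _≈_ _*_ _+_ →
  CommutativeRing c ℓ
mkCommutativeRing {_≈_ = _≈_} {_+_} {_*_} { -_} 0# 1#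
  eq +-cong -‿cong *-cong +-assoc +-comm +-idˡ -‿invˡ *-assoc *-comm *-idˡ distribˡ = record
  { isCommutativeRing = record
    { isRing = record
      { +-isAbelianGroup = record
        { isGroup = record
          { isMonoid = record
            { isSemigroup = record
              { isMagma = record { isEquivalence = eq ; ∙-cong = +-cong }
              ; assoc   = +-assoc
              }
            ; identity = comm∧idˡ⇒id S +-comm +-idˡ
            }
          ; inverse = comm∧invˡ⇒inv S +-comm -‿invˡ
          ; ⁻¹-cong = -‿cong
          }
        ; comm = +-comm
        }
      ; *-cong     = *-cong
      ; *-assoc    = *-assoc
      ; *-identity = comm∧idˡ⇒id S *-comm *-idˡ
      ; distrib    = comm∧distrˡ⇒distr S +-cong *-comm distribˡ
      }
    ; *-comm = *-comm
    }
  }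
  where S = record { isEquivalence = eq }

------------------------------------------------------------------------
-- Real numbers: Cauchy sequences of rationals modulo null sequences.

module Real where

  open import Data.Rational.Base using (_+_; _*_; _-_; -_)
  open Rat.≤-Reasoning
  open ≡ using (refl; sym; trans; cong; cong₂; subst)

  record ℝ : Set where
    constructor mkℝ
    field
      seq    : ℕ → ℚ
      cauchy : ∀ {ε} → 0ℚ < ε →
               ∃ λ M → ∀ {m n} → M ℕ.≤ m → M ℕ.≤ n → ∣ seq m - seq n ∣ < ε

  open ℝ public

  infix 4 _≈_
  record _≈_ (x y : ℝ) : Set where
    constructor mk≈
    field
      close : ∀ {ε} → 0ℚ < ε →
              ∃ λ M → ∀ {n} → M ℕ.≤ n → ∣ seq x n - seq y n ∣ < ε

  open _≈_ public

  half : ∀ {ε} → 0ℚ < ε → 0ℚ < ½ * ε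
  half {ε} 0<ε = begin-strict
    0ℚ      ≡⟨ Rat.*-zeroʳ ½ ⟨
    ½ * 0ℚ  <⟨ Rat.*-monoʳ-<-pos ½ 0<ε ⟩
    ½ * ε   ∎

  halves : ∀ ε → ½ * ε + ½ * ε ≡ ε
  halves ε = trans (sym (Rat.*-distribʳ-+ ε ½ ½)) (Rat.*-identityˡ ε)

  ∣+∣< : ∀ {a b δ ε} → ∣ a ∣ < δ → ∣ b ∣ < ε → ∣ a + b ∣ < δ + ε
  ∣+∣< {a} {b} a< b< = Rat.≤-<-trans (Rat.∣p+q∣≤∣p∣+∣q∣ a b) (Rat.+-mono-< a< b<)

  ∣+∣<½ : ∀ {a b ε} → ∣ a ∣ < ½ * ε → ∣ b ∣ < ½ * ε → ∣ a + b ∣ < ε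
  ∣+∣<½ {ε = ε} a< b< = subst (_ <_) (halves ε) (∣+∣< a< b<)

  ∣-∣-sym : ∀ a b → ∣ a - b ∣ ≡ ∣ b - a ∣
  ∣-∣-sym a b = trans (sym (Rat.∣-p∣≡∣p∣ (a - b))) (cong ∣_∣ (lem a b))
    where
    open +-*-Solver
    lem : ∀ a b → - (a - b) ≡ b - a
    lem = solve 2 (λ a b → :- (a :- b) := b :- a) refl

  +-split : ∀ a b c d → (a + b) - (c + d) ≡ (a - c) + (b - d)
  +-split = solve 4 (λ a b c d → (a :+ b) :- (c :+ d) := (a :- c) :+ (b :- d)) refl
    where open +-*-Solver

  -‿split : ∀ a b → - a - - b ≡ b - a
  -‿split = solve 2 (λ a b → :- a :- :- b := b :- a) refl
    where open +-*-Solver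

  *-split : ∀ a b c d → a * b - c * d ≡ a * (b - d) + (a - c) * d
  *-split = solve 4 (λ a b c d → a :* b :- c :* d := a :* (b :- d) :+ (a :- c) :* d) refl
    where open +-*-Solver

  telescope : ∀ a b c → a - c ≡ (a - b) + (b - c)
  telescope = solve 3 (λ a b c → a :- c := (a :- b) :+ (b :- c)) refl
    where open +-*-Solver

  restore : ∀ a b → a ≡ (a - b) + b
  restore = solve 2 (λ a b → a := (a :- b) :+ b) refl
    where open +-*-Solver

  ∣*∣< : ∀ {a b B δ} → 0ℚ < B → ∣ a ∣ < B → ∣ b ∣ < δ → ∣ a * b ∣ < B * δ
  ∣*∣< {a} {b} {B} {δ} 0<B a< b< = begin-strict
    ∣ a * b ∣      ≡⟨ Rat.∣p*q∣≡∣p∣*∣q∣ a b ⟩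
    ∣ a ∣ * ∣ b ∣  ≤⟨ Rat.*-monoʳ-≤-nonNeg ∣ b ∣ {{Rat.∣-∣-nonNeg b}} (Rat.<⇒≤ a<) ⟩
    B * ∣ b ∣      <⟨ Rat.*-monoʳ-<-pos B {{Rat.positive 0<B}} b< ⟩
    B * δ          ∎

  ∣*-*∣< : ∀ {a b c d B δ} → 0ℚ < B → ∣ a ∣ < B → ∣ d ∣ < B →
           ∣ a - c ∣ < δ → ∣ b - d ∣ < δ → ∣ a * b - c * d ∣ < B * δ + B * δ
  ∣*-*∣< {a} {b} {c} {d} {B} {δ} 0<B a< d< ac bd = begin-strict
    ∣ a * b - c * d ∣              ≡⟨ cong ∣_∣ (*-split a b c d) ⟩
    ∣ a * (b - d) + (a - c) * d ∣  ≡⟨ cong (λ z → ∣ a * (b - d) + z ∣) (Rat.*-comm (a - c) d) ⟩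
    ∣ a * (b - d) + d * (a - c) ∣  <⟨ ∣+∣< (∣*∣< 0<B a< bd) (∣*∣< 0<B d< ac) ⟩
    B * δ + B * δ                  ∎

  scale : ∀ {B ε} → 0ℚ < B → 0ℚ < ε → ∃ λ δ → 0ℚ < δ × B * δ + B * δ ≡ ε
  scale {B} {ε} 0<B 0<ε = δ , 0<δ , trans (cong₂ _+_ Bδ Bδ) (halves ε)
    where
    instance
      B-pos : Rat.Positive B
      B-pos = Rat.positive 0<B
      B-nonZero : Rat.NonZero B
      B-nonZero = Rat.pos⇒nonZero B
      B⁻¹-pos : Rat.Positive (Rat.1/ B)
      B⁻¹-pos = Rat.1/pos⇒pos B
    δ = Rat.1/ B * (½ * ε)
    0<δ : 0ℚ < δ
    0<δ = subst (_< δ) (Rat.*-zeroʳ (Rat.1/ B)) (Rat.*-monoʳ-<-pos (Rat.1/ B) (half 0<ε))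
    Bδ : B * δ ≡ ½ * ε
    Bδ = begin-equality
      B * (Rat.1/ B * (½ * ε))  ≡⟨ Rat.*-assoc B (Rat.1/ B) (½ * ε) ⟨
      B * Rat.1/ B * (½ * ε)    ≡⟨ cong (_* (½ * ε)) (Rat.*-inverseʳ B) ⟩
      1ℚ * (½ * ε)              ≡⟨ Rat.*-identityˡ (½ * ε) ⟩
      ½ * ε                     ∎

  <-+ʳ : ∀ p q → 0ℚ < q → p < p + q
  <-+ʳ p q 0<q = begin-strict
    p       ≡⟨ Rat.+-identityʳ p ⟨
    p + 0ℚ  <⟨ Rat.+-monoʳ-< p {0ℚ} {q} 0<q ⟩
    p + q   ∎

  <-+ˡ : ∀ p q → 0ℚ < p → q < p + q
  <-+ˡ p q 0<p = begin-strict
    q       ≡⟨ Rat.+-identityˡ q ⟨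
    0ℚ + q  <⟨ Rat.+-monoˡ-< q {0ℚ} {p} 0<p ⟩
    p + q   ∎

  bounded : ∀ x → ∃ λ B → ∃ λ M → 0ℚ < B × (∀ {n} → M ℕ.≤ n → ∣ seq x n ∣ < B)
  bounded x with cauchy x (Rat.positive⁻¹ 1ℚ)
  ... | M , c = 1ℚ + ∣ seq x M ∣ , M , 0<B , λ {n} M≤n → begin-strict
    ∣ seq x n ∣                        ≡⟨ cong ∣_∣ (restore (seq x n) (seq x M)) ⟩
    ∣ (seq x n - seq x M) + seq x M ∣  ≤⟨ Rat.∣p+q∣≤∣p∣+∣q∣ (seq x n - seq x M) (seq x M) ⟩
    ∣ seq x n - seq x M ∣ + ∣ seq x M ∣ <⟨ Rat.+-monoˡ-< ∣ seq x M ∣ (c M≤n ℕ.≤-refl) ⟩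
    1ℚ + ∣ seq x M ∣                   ∎
    where
    0<B : 0ℚ < 1ℚ + ∣ seq x M ∣
    0<B = Rat.+-mono-<-≤ (Rat.positive⁻¹ 1ℚ) (Rat.0≤∣p∣ (seq x M))

  jointly-bounded : ∀ x y → ∃ λ B → ∃ λ M → 0ℚ < B ×
                    (∀ {n} → M ℕ.≤ n → ∣ seq x n ∣ < B × ∣ seq y n ∣ < B)
  jointly-bounded x y = joint (bounded x) (bounded y)
    where
    joint : (∃ λ B → ∃ λ M → 0ℚ < B × (∀ {n} → M ℕ.≤ n → ∣ seq x n ∣ < B)) →
            (∃ λ B → ∃ λ M → 0ℚ < B × (∀ {n} → M ℕ.≤ n → ∣ seq y n ∣ < B)) →
            ∃ λ B → ∃ λ M → 0ℚ < B ×
                    (∀ {n} → M ℕ.≤ n → ∣ seq x n ∣ < B × ∣ seq y n ∣ < B)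
    joint (B , M , 0<B , b) (B′ , M′ , 0<B′ , b′) = S , M ℕ.⊔ M′ , p , q
      where
      S : ℚ
      S = B + B′
      p : 0ℚ < S
      p = Rat.<-trans {0ℚ} {B} {S} 0<B (<-+ʳ B B′ 0<B′)
      q : ∀ {n} → M ℕ.⊔ M′ ℕ.≤ n → ∣ seq x n ∣ < S × ∣ seq y n ∣ < S
      q {n} le =
        Rat.<-trans {∣ seq x n ∣} {B} {S} (b (ℕ.m⊔n≤o⇒m≤o M M′ le)) (<-+ʳ B B′ 0<B′) ,
        Rat.<-trans {∣ seq y n ∣} {B′} {S} (b′ (ℕ.m⊔n≤o⇒n≤o M M′ le)) (<-+ˡ B B′ 0<B)

  -- Operations are opaque so that the type checker never unfolds the
  -- rational arithmetic inside the Cauchy proofs.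

  infixl 6 _+ᴿ_
  infixl 7 _*ᴿ_
  infix  8 -ᴿ_

  opaque

    _+ᴿ_ : ℝ → ℝ → ℝ
    x +ᴿ y = mkℝ (λ n → seq x n + seq y n) c
      where
      c : ∀ {ε} → 0ℚ < ε → ∃ λ M → ∀ {m n} → M ℕ.≤ m → M ℕ.≤ n →
          ∣ (seq x m + seq y m) - (seq x n + seq y n) ∣ < ε
      c {ε} 0<ε = let (M , p) = cauchy x (half 0<ε); (M′ , q) = cauchy y (half 0<ε) in
        M ℕ.⊔ M′ , λ {m} {n} l l′ →
        subst (λ z → ∣ z ∣ < ε) (sym (+-split (seq x m) (seq y m) (seq x n) (seq y n)))
          (∣+∣<½ (p (ℕ.m⊔n≤o⇒m≤o M M′ l) (ℕ.m⊔n≤o⇒m≤o M M′ l′))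
                 (q (ℕ.m⊔n≤o⇒n≤o M M′ l) (ℕ.m⊔n≤o⇒n≤o M M′ l′)))

    -ᴿ_ : ℝ → ℝ
    -ᴿ x = mkℝ (λ n → - seq x n) c
      where
      c : ∀ {ε} → 0ℚ < ε → ∃ λ M → ∀ {m n} → M ℕ.≤ m → M ℕ.≤ n →
          ∣ - seq x m - - seq x n ∣ < ε
      c {ε} 0<ε = let (M , p) = cauchy x 0<ε in M , λ {m} {n} l l′ →
        subst (λ z → ∣ z ∣ < ε) (sym (-‿split (seq x m) (seq x n))) (p l′ l)

    _*ᴿ_ : ℝ → ℝ → ℝ
    x *ᴿ y = mkℝ (λ n → seq x n * seq y n) c
      where
      c : ∀ {ε} → 0ℚ < ε → ∃ λ M → ∀ {m n} → M ℕ.≤ m → M ℕ.≤ n →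
          ∣ seq x m * seq y m - seq x n * seq y n ∣ < ε
      c {ε} 0<ε =
        let (B , L , 0<B , b) = jointly-bounded x y
            (δ , 0<δ , δ-eq)  = scale 0<B 0<ε
            (M , p)           = cauchy x 0<δ
            (M′ , q)          = cauchy y 0<δ
        in L ℕ.⊔ (M ℕ.⊔ M′) , λ {m} {n} l l′ →
        let r  = ℕ.m⊔n≤o⇒n≤o L (M ℕ.⊔ M′) l
            r′ = ℕ.m⊔n≤o⇒n≤o L (M ℕ.⊔ M′) l′
        in subst (∣ seq x m * seq y m - seq x n * seq y n ∣ <_) δ-eq
           (∣*-*∣< {seq x m} {seq y m} {seq x n} {seq y n} 0<B
             (proj₁ (b (ℕ.m⊔n≤o⇒m≤o L _ l))) (proj₂ (b (ℕ.m⊔n≤o⇒m≤o L _ l′)))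
             (p (ℕ.m⊔n≤o⇒m≤o M M′ r) (ℕ.m⊔n≤o⇒m≤o M M′ r′))
             (q (ℕ.m⊔n≤o⇒n≤o M M′ r) (ℕ.m⊔n≤o⇒n≤o M M′ r′)))

    constᴿ : ℚ → ℝ
    constᴿ q = mkℝ (λ _ → q) λ {ε} 0<ε → 0 , λ _ _ →
      subst (_< ε) (cong ∣_∣ (sym (Rat.+-inverseʳ q))) 0<ε

  0ᴿ 1ᴿ : ℝ
  0ᴿ = constᴿ 0ℚ
  1ᴿ = constᴿ 1ℚ

  opaque

    pointwise : ∀ {x y} → (∀ n → seq x n ≡ seq y n) → x ≈ y
    pointwise {x} {y} eq = mk≈ λ {ε} 0<ε → 0 , λ {n} _ →
      subst (_< ε) (cong ∣_∣ (sym (trans (cong (_- seq y n) (eq n)) (Rat.+-inverseʳ (seq y n))))) 0<ε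

    ≈-refl : ∀ {x} → x ≈ x
    ≈-refl = pointwise λ _ → refl

    ≈-sym : ∀ {x y} → x ≈ y → y ≈ x
    ≈-sym {x} {y} (mk≈ e) = mk≈ λ {ε} 0<ε → let (M , p) = e 0<ε in
      M , λ {n} l → subst (_< ε) (∣-∣-sym (seq x n) (seq y n)) (p l)

    ≈-trans : ∀ {x y z} → x ≈ y → y ≈ z → x ≈ z
    ≈-trans {x} {y} {z} (mk≈ e) (mk≈ f) = mk≈ λ {ε} 0<ε →
      let (M , p) = e (half 0<ε); (M′ , q) = f (half 0<ε) in
      M ℕ.⊔ M′ , λ {n} l →
        subst (λ w → ∣ w ∣ < ε) (sym (telescope (seq x n) (seq y n) (seq z n)))
          (∣+∣<½ (p (ℕ.m⊔n≤o⇒m≤o M M′ l)) (q (ℕ.m⊔n≤o⇒n≤o M M′ l)))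

  opaque
    unfolding _+ᴿ_ -ᴿ_ _*ᴿ_ constᴿ pointwise

    +ᴿ-cong : Congruent₂ _≈_ _+ᴿ_
    +ᴿ-cong {x} {y} {u} {v} (mk≈ e) (mk≈ f) = mk≈ λ {ε} 0<ε →
      let (M , p) = e (half 0<ε); (M′ , q) = f (half 0<ε) in
      M ℕ.⊔ M′ , λ {n} l →
        subst (λ w → ∣ w ∣ < ε) (sym (+-split (seq x n) (seq u n) (seq y n) (seq v n)))
          (∣+∣<½ (p (ℕ.m⊔n≤o⇒m≤o M M′ l)) (q (ℕ.m⊔n≤o⇒n≤o M M′ l)))

    -ᴿ-cong : Congruent₁ _≈_ -ᴿ_
    -ᴿ-cong {x} {y} (mk≈ e) = mk≈ λ {ε} 0<ε → let (M , p) = e 0<ε in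
      M , λ {n} l → subst (_< ε)
        (trans (∣-∣-sym (seq x n) (seq y n)) (cong ∣_∣ (sym (-‿split (seq x n) (seq y n))))) (p l)

    *ᴿ-cong : Congruent₂ _≈_ _*ᴿ_
    *ᴿ-cong {x} {y} {u} {v} (mk≈ e) (mk≈ f) = mk≈ c
      where
      c : ∀ {ε} → 0ℚ < ε → ∃ λ M → ∀ {n} → M ℕ.≤ n →
          ∣ seq x n * seq u n - seq y n * seq v n ∣ < ε
      c {ε} 0<ε =
        let (B , L , 0<B , b) = jointly-bounded x v
            (δ , 0<δ , δ-eq)  = scale 0<B 0<ε
            (M , p)           = e 0<δ
            (M′ , q)          = f 0<δ
        in L ℕ.⊔ (M ℕ.⊔ M′) , λ {n} l →
        let r       = ℕ.m⊔n≤o⇒n≤o L (M ℕ.⊔ M′) l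
            (s , t) = b (ℕ.m⊔n≤o⇒m≤o L _ l)
        in subst (∣ seq x n * seq u n - seq y n * seq v n ∣ <_) δ-eq
           (∣*-*∣< {seq x n} {seq u n} {seq y n} {seq v n} 0<B s t
             (p (ℕ.m⊔n≤o⇒m≤o M M′ r)) (q (ℕ.m⊔n≤o⇒n≤o M M′ r)))

    +ᴿ-assoc : Associative _≈_ _+ᴿ_
    +ᴿ-assoc x y z = pointwise λ n → Rat.+-assoc (seq x n) (seq y n) (seq z n)

    +ᴿ-comm : Commutative _≈_ _+ᴿ_
    +ᴿ-comm x y = pointwise λ n → Rat.+-comm (seq x n) (seq y n)

    +ᴿ-identityˡ : LeftIdentity _≈_ 0ᴿ _+ᴿ_
    +ᴿ-identityˡ x = pointwise λ n → Rat.+-identityˡ (seq x n)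

    -ᴿ-inverseˡ : LeftInverse _≈_ 0ᴿ -ᴿ_ _+ᴿ_
    -ᴿ-inverseˡ x = pointwise λ n → Rat.+-inverseˡ (seq x n)

    *ᴿ-assoc : Associative _≈_ _*ᴿ_
    *ᴿ-assoc x y z = pointwise λ n → Rat.*-assoc (seq x n) (seq y n) (seq z n)

    *ᴿ-comm : Commutative _≈_ _*ᴿ_
    *ᴿ-comm x y = pointwise λ n → Rat.*-comm (seq x n) (seq y n)

    *ᴿ-identityˡ : LeftIdentity _≈_ 1ᴿ _*ᴿ_
    *ᴿ-identityˡ x = pointwise λ n → Rat.*-identityˡ (seq x n)

    *ᴿ-distribˡ : _DistributesOverˡ_ _≈_ _*ᴿ_ _+ᴿ_
    *ᴿ-distribˡ x y z = pointwise λ n → Rat.*-distribˡ-+ (seq x n) (seq y n) (seq z n)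

  ℝ-commutativeRing : CommutativeRing 0ℓ 0ℓ
  ℝ-commutativeRing = mkCommutativeRing 0ᴿ 1ᴿ
    record { refl = ≈-refl ; sym = ≈-sym ; trans = ≈-trans }
    +ᴿ-cong -ᴿ-cong *ᴿ-cong +ᴿ-assoc +ᴿ-comm +ᴿ-identityˡ -ᴿ-inverseˡ
    *ᴿ-assoc *ᴿ-comm *ᴿ-identityˡ *ᴿ-distribˡ

------------------------------------------------------------------------
-- Complex numbers

module Gaussian {c ℓ} (R : CommutativeRing c ℓ) where

  open CommutativeRing R
  open RingProperties ring using (-1*x≈-x; -‿distribʳ-*)

  infix  4 _≈ᶜ_
  infixl 6 _+ᶜ_
  infixl 7 _*ᶜ_
  infix  8 -ᶜ_

  record Complex : Set c where
    constructor _+i_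
    field
      re im : Carrier

  open Complex public

  record _≈ᶜ_ (z w : Complex) : Set ℓ where
    constructor _,_
    field
      re≈ : re z ≈ re w
      im≈ : im z ≈ im w

  open _≈ᶜ_ public

  _+ᶜ_ _*ᶜ_ : Complex → Complex → Complex
  z +ᶜ w = (re z + re w) +i (im z + im w)
  z *ᶜ w = (re z * re w - im z * im w) +i (re z * im w + im z * re w)

  -ᶜ_ : Complex → Complex
  -ᶜ z = (- re z) +i (- im z)

  0ᶜ 1ᶜ : Complex
  0ᶜ = 0# +i 0#
  1ᶜ = 1# +i 0#

  private

    -- Multiplication with i² replaced by an arbitrary element s, so that the
    -- semiring solver applies.
    module _ (s : Carrier) where

      _⊛_ : Complex → Complex → Complex
      z ⊛ w = (re z * re w + s * (im z * im w)) +i (re z * im w + im z * re w)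

      open SemiringSolver commutativeSemiring

      ⊛-assoc : ∀ x y z → ((x ⊛ y) ⊛ z) ≈ᶜ (x ⊛ (y ⊛ z))
      ⊛-assoc (a +i b) (c +i d) (e +i f) =
        solve 7 (λ s a b c d e f →
          (a :* c :+ s :* (b :* d)) :* e :+ s :* ((a :* d :+ b :* c) :* f) :=
          a :* (c :* e :+ s :* (d :* f)) :+ s :* (b :* (c :* f :+ d :* e)))
          refl s a b c d e f ,
        solve 7 (λ s a b c d e f →
          (a :* c :+ s :* (b :* d)) :* f :+ (a :* d :+ b :* c) :* e :=
          a :* (c :* f :+ d :* e) :+ b :* (c :* e :+ s :* (d :* f)))
          refl s a b c d e f

      ⊛-distribˡ : ∀ x y z → (x ⊛ (y +ᶜ z)) ≈ᶜ ((x ⊛ y) +ᶜ (x ⊛ z))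
      ⊛-distribˡ (a +i b) (c +i d) (e +i f) =
        solve 7 (λ s a b c d e f →
          a :* (c :+ e) :+ s :* (b :* (d :+ f)) :=
          (a :* c :+ s :* (b :* d)) :+ (a :* e :+ s :* (b :* f)))
          refl s a b c d e f ,
        solve 7 (λ s a b c d e f →
          a :* (d :+ f) :+ b :* (c :+ e) :=
          (a :* d :+ b :* c) :+ (a :* f :+ b :* e))
          refl s a b c d e f

      ⊛-comm : ∀ z w → (z ⊛ w) ≈ᶜ (w ⊛ z)
      ⊛-comm (a +i b) (c +i d) =
        solve 5 (λ s a b c d →
          a :* c :+ s :* (b :* d) := c :* a :+ s :* (d :* b)) refl s a b c d ,
        solve 5 (λ s a b c d →
          a :* d :+ b :* c := c :* b :+ d :* a) refl s a b c d

      ⊛-identityˡ : ∀ z → (1ᶜ ⊛ z) ≈ᶜ z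
      ⊛-identityˡ (a +i b) =
        solve 3 (λ s a b → con 1 :* a :+ s :* (con 0 :* b) := a) refl s a b ,
        solve 3 (λ s a b → con 1 :* b :+ con 0 :* a := b) refl s a b

    ≈ᶜ-isEquivalence : IsEquivalence _≈ᶜ_
    ≈ᶜ-isEquivalence = record
      { refl  = refl , refl
      ; sym   = λ (p , q) → sym p , sym q
      ; trans = λ (p , q) (r , s) → trans p r , trans q s
      }

    open IsEquivalence ≈ᶜ-isEquivalence using ()
      renaming (sym to ≈ᶜ-sym; trans to ≈ᶜ-trans)

    +ᶜ-cong : Congruent₂ _≈ᶜ_ _+ᶜ_
    +ᶜ-cong (p , q) (r , s) = +-cong p r , +-cong q s

    *ᶜ-cong : Congruent₂ _≈ᶜ_ _*ᶜ_
    *ᶜ-cong (p , q) (r , s) =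
      +-cong (*-cong p r) (-‿cong (*-cong q s)) , +-cong (*-cong p s) (*-cong q r)

    infixl 7 _⊙_
    _⊙_ : Complex → Complex → Complex
    _⊙_ = _⊛_ (- 1#)

    *ᶜ≈⊙ : ∀ z w → (z *ᶜ w) ≈ᶜ (z ⊙ w)
    *ᶜ≈⊙ z w = +-congˡ (sym (-1*x≈-x (im z * im w))) , refl

    *ᶜ-assoc : Associative _≈ᶜ_ _*ᶜ_
    *ᶜ-assoc x y z =
      ≈ᶜ-trans (*ᶜ-cong (*ᶜ≈⊙ x y) (refl , refl))
      (≈ᶜ-trans (*ᶜ≈⊙ (x ⊙ y) z)
      (≈ᶜ-trans (⊛-assoc (- 1#) x y z)
      (≈ᶜ-trans (≈ᶜ-sym (*ᶜ≈⊙ x (y ⊙ z)))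
      (*ᶜ-cong (refl , refl) (≈ᶜ-sym (*ᶜ≈⊙ y z))))))

    *ᶜ-comm : Commutative _≈ᶜ_ _*ᶜ_
    *ᶜ-comm x y =
      ≈ᶜ-trans (*ᶜ≈⊙ x y) (≈ᶜ-trans (⊛-comm (- 1#) x y) (≈ᶜ-sym (*ᶜ≈⊙ y x)))

    *ᶜ-identityˡ : LeftIdentity _≈ᶜ_ 1ᶜ _*ᶜ_
    *ᶜ-identityˡ x = ≈ᶜ-trans (*ᶜ≈⊙ 1ᶜ x) (⊛-identityˡ (- 1#) x)

    *ᶜ-distribˡ : _DistributesOverˡ_ _≈ᶜ_ _*ᶜ_ _+ᶜ_
    *ᶜ-distribˡ x y z =
      ≈ᶜ-trans (*ᶜ≈⊙ x (y +ᶜ z))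
      (≈ᶜ-trans (⊛-distribˡ (- 1#) x y z)
      (+ᶜ-cong (≈ᶜ-sym (*ᶜ≈⊙ x y)) (≈ᶜ-sym (*ᶜ≈⊙ x z))))

  commutativeRing : CommutativeRing c ℓ
  commutativeRing = mkCommutativeRing 0ᶜ 1ᶜ
    ≈ᶜ-isEquivalence
    +ᶜ-cong (λ (p , q) → -‿cong p , -‿cong q) *ᶜ-cong
    (λ x y z → +-assoc (re x) (re y) (re z) , +-assoc (im x) (im y) (im z))
    (λ x y → +-comm (re x) (re y) , +-comm (im x) (im y))
    (λ x → +-identityˡ (re x) , +-identityˡ (im x))
    (λ x → -‿inverseˡ (re x) , -‿inverseˡ (im x))
    *ᶜ-assoc *ᶜ-comm *ᶜ-identityˡ *ᶜ-distribˡ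

ℂ-commutativeRing : CommutativeRing 0ℓ 0ℓ
ℂ-commutativeRing = Gaussian.commutativeRing Real.ℝ-commutativeRing

module ℂ where

  open CommutativeRing ℂ-commutativeRing public
  open RawSemiringDefs (Semiring.rawSemiring semiring) public
    using (_^_; sum; product) renaming (_×_ to _×ⁿ_)

  fromℕ : ℕ → Carrier
  fromℕ n = n ×ⁿ 1#

  -- sum₁ n f = f 1 + f 2 + ⋯ + f n
  sum₁ : ℕ → (ℕ → Carrier) → Carrier
  sum₁ n f = sum {n} λ m → f (suc (toℕ m))

ℂ : Set
ℂ = ℂ.Carrier

------------------------------------------------------------------------
-- Groups

module Units {c ℓ} (R : CommutativeRing c ℓ) where

  open CommutativeRing R
  open CommutativeSemigroupProperties *-commutativeSemigroup using (interchange)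
  open import Relation.Binary.Reasoning.Setoid setoid

  record Unit : Set (c ⊔ ℓ) where
    constructor unit
    field
      val     : Carrier
      inv     : Carrier
      inverse : val * inv ≈ 1#

  open Unit public

  private

    inv-cong : ∀ {x y} → val x ≈ val y → inv x ≈ inv y
    inv-cong {x} {y} eq = begin
      inv x                    ≈⟨ *-identityʳ (inv x) ⟨
      inv x * 1#               ≈⟨ *-congˡ (inverse y) ⟨
      inv x * (val y * inv y)  ≈⟨ *-assoc (inv x) (val y) (inv y) ⟨
      inv x * val y * inv y    ≈⟨ *-congʳ (*-congˡ eq) ⟨
      inv x * val x * inv y    ≈⟨ *-congʳ (trans (*-comm (inv x) (val x)) (inverse x)) ⟩
      1# * inv y               ≈⟨ *-identityˡ (inv y) ⟩
      inv y                    ∎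

    _∙_ : Unit → Unit → Unit
    unit a a⁻¹ p ∙ unit b b⁻¹ q = unit (a * b) (a⁻¹ * b⁻¹)
      (trans (interchange a b a⁻¹ b⁻¹) (trans (*-cong p q) (*-identityˡ 1#)))

  unitGroup : AbelianGroup (c ⊔ ℓ) ℓ
  unitGroup = record
    { Carrier = Unit
    ; _≈_ = λ x y → val x ≈ val y
    ; _∙_ = _∙_
    ; ε = unit 1# 1# (*-identityˡ 1#)
    ; _⁻¹ = λ x → unit (inv x) (val x) (trans (*-comm (inv x) (val x)) (inverse x))
    ; isAbelianGroup = record
      { isGroup = record
        { isMonoid = record
          { isSemigroup = record
            { isMagma = record
              { isEquivalence = record { refl = refl ; sym = sym ; trans = trans }
              ; ∙-cong = *-cong
              }
            ; assoc = λ x y z → *-assoc (val x) (val y) (val z)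
            }
          ; identity = (λ x → *-identityˡ (val x)) , (λ x → *-identityʳ (val x))
          }
        ; inverse = (λ x → trans (*-comm (inv x) (val x)) (inverse x)) , inverse
        ; ⁻¹-cong = λ {x} {y} → inv-cong {x} {y}
        }
      ; comm = λ x y → *-comm (val x) (val y)
      }
    }

module Hom {a ℓ₁ b ℓ₂} (G : Group a ℓ₁) (H : AbelianGroup b ℓ₂) where

  private
    module G = Group G
  open AbelianGroup H
  open AbelianGroupProperties H using (⁻¹-∙-comm; ε⁻¹≈ε)
  open CommutativeSemigroupProperties commutativeSemigroup using (interchange)
  open GroupHomomorphism

  private

    hom : (f : G.Carrier → Carrier) →
          (∀ {x y} → x G.≈ y → f x ≈ f y) →
          (∀ x y → f (x G.∙ y) ≈ f x ∙ f y) →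
          f G.ε ≈ ε →
          (∀ x → f (x G.⁻¹) ≈ f x ⁻¹) →
          GroupHomomorphism G.rawGroup rawGroup
    hom f cong homo ε-homo ⁻¹-homo = record
      { ⟦_⟧ = f
      ; isGroupHomomorphism = record
        { isMonoidHomomorphism = record
          { isMagmaHomomorphism = record
            { isRelHomomorphism = record { cong = cong }
            ; homo = homo
            }
          ; ε-homo = ε-homo
          }
        ; ⁻¹-homo = ⁻¹-homo
        }
      }

  homGroup : AbelianGroup (a ⊔ ℓ₁ ⊔ b ⊔ ℓ₂) (a ⊔ ℓ₂)
  homGroup = record
    { Carrier = GroupHomomorphism G.rawGroup rawGroup
    ; _≈_ = λ f g → ∀ x → ⟦ f ⟧ x ≈ ⟦ g ⟧ x
    ; _∙_ = λ f g → hom (λ x → ⟦ f ⟧ x ∙ ⟦ g ⟧ x)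
        (λ eq → ∙-cong (⟦⟧-cong f eq) (⟦⟧-cong g eq))
        (λ x y → trans (∙-cong (homo f x y) (homo g x y)) (interchange _ _ _ _))
        (trans (∙-cong (ε-homo f) (ε-homo g)) (identityˡ ε))
        (λ x → trans (∙-cong (⁻¹-homo f x) (⁻¹-homo g x)) (⁻¹-∙-comm _ _))
    ; ε = hom (λ _ → ε) (λ _ → refl) (λ _ _ → sym (identityˡ ε)) refl (λ _ → sym ε⁻¹≈ε)
    ; _⁻¹ = λ f → hom (λ x → ⟦ f ⟧ x ⁻¹)
        (λ eq → ⁻¹-cong (⟦⟧-cong f eq))
        (λ x y → trans (⁻¹-cong (homo f x y)) (sym (⁻¹-∙-comm _ _)))
        (trans (⁻¹-cong (ε-homo f)) ε⁻¹≈ε)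
        (λ x → ⁻¹-cong (⁻¹-homo f x))
    ; isAbelianGroup = record
      { isGroup = record
        { isMonoid = record
          { isSemigroup = record
            { isMagma = record
              { isEquivalence = record
                { refl = λ _ → refl
                ; sym = λ p x → sym (p x)
                ; trans = λ p q x → trans (p x) (q x)
                }
              ; ∙-cong = λ p q x → ∙-cong (p x) (q x)
              }
            ; assoc = λ f g h x → assoc _ _ _
            }
          ; identity = (λ f x → identityˡ _) , (λ f x → identityʳ _)
          }
        ; inverse = (λ f x → inverseˡ _) , (λ f x → inverseʳ _)
        ; ⁻¹-cong = λ p x → ⁻¹-cong (p x)
        }
      ; comm = λ f g x → comm _ _
      }
    }

module Powers {c ℓ} (G : Group c ℓ) where

  open import Data.Integer.Base using (ℤ; +_; -[1+_])
  open Group G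
  open RawMonoidDefs rawMonoid using () renaming (_×_ to _times_)

  infixr 8 _^_
  _^_ : Carrier → ℤ → Carrier
  g ^ (+ n)    = n times g
  g ^ -[1+ n ] = (suc n times g) ⁻¹

  HasOrder : Carrier → ℕ → Set ℓ
  HasOrder g n = 0 ℕ.< n × g ^ (+ n) ≈ ε × (∀ m → 0 ℕ.< m → m ℕ.< n → ¬ (g ^ (+ m) ≈ ε))

------------------------------------------------------------------------
-- The prime field

module Modular (n : ℕ) .{{_ : NonZero n}} where

  open import Data.Nat.Base using (_+_; _*_)
  open ≡ using (refl; sym; trans; cong; cong₂)
  open ≡.≡-Reasoning

  infixl 6 _+ᶠ_
  infixl 7 _*ᶠ_
  infix  8 -ᶠ_

  _+ᶠ_ _*ᶠ_ : Fin n → Fin n → Fin n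
  x +ᶠ y = (toℕ x + toℕ y) mod n
  x *ᶠ y = (toℕ x * toℕ y) mod n

  -ᶠ_ : Fin n → Fin n
  -ᶠ x = (n ∸ toℕ x) mod n

  toℕ-mod : ∀ a → toℕ (a mod n) ≡ a % n
  toℕ-mod a = Fin.toℕ-fromℕ< (m%n<n a n)

  mod-cong : ∀ {a b} → a % n ≡ b % n → a mod n ≡ b mod n
  mod-cong {a} {b} eq =
    Fin.toℕ-injective (trans (toℕ-mod a) (trans eq (sym (toℕ-mod b))))

  toℕ-mod-inverse : ∀ x → toℕ x mod n ≡ x
  toℕ-mod-inverse x =
    Fin.toℕ-injective (trans (toℕ-mod (toℕ x)) (m<n⇒m%n≡m (Fin.toℕ<n x)))

  mod-+ : ∀ a b → (a mod n) +ᶠ (b mod n) ≡ (a + b) mod n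
  mod-+ a b = mod-cong (begin
    (toℕ (a mod n) + toℕ (b mod n)) % n  ≡⟨ cong₂ (λ u v → (u + v) % n) (toℕ-mod a) (toℕ-mod b) ⟩
    (a % n + b % n) % n                  ≡⟨ %-distribˡ-+ a b n ⟨
    (a + b) % n                          ∎)

  mod-* : ∀ a b → (a mod n) *ᶠ (b mod n) ≡ (a * b) mod n
  mod-* a b = mod-cong (begin
    (toℕ (a mod n) * toℕ (b mod n)) % n  ≡⟨ cong₂ (λ u v → (u * v) % n) (toℕ-mod a) (toℕ-mod b) ⟩
    (a % n * (b % n)) % n                ≡⟨ %-distribˡ-* a b n ⟨
    (a * b) % n                          ∎)

  opaque

    +ᶠ-assoc : Associative _≡_ _+ᶠ_
    +ᶠ-assoc x y z = begin
      (x +ᶠ y) +ᶠ z                                ≡⟨ cong ((x +ᶠ y) +ᶠ_) (toℕ-mod-inverse z) ⟨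
      (x +ᶠ y) +ᶠ (toℕ z mod n)                    ≡⟨ mod-+ (toℕ x + toℕ y) (toℕ z) ⟩
      (toℕ x + toℕ y + toℕ z) mod n                ≡⟨ cong (_mod n) (ℕ.+-assoc (toℕ x) (toℕ y) (toℕ z)) ⟩
      (toℕ x + (toℕ y + toℕ z)) mod n              ≡⟨ mod-+ (toℕ x) (toℕ y + toℕ z) ⟨
      (toℕ x mod n) +ᶠ (y +ᶠ z)                    ≡⟨ cong (_+ᶠ (y +ᶠ z)) (toℕ-mod-inverse x) ⟩
      x +ᶠ (y +ᶠ z)                                ∎

    *ᶠ-assoc : Associative _≡_ _*ᶠ_
    *ᶠ-assoc x y z = begin
      (x *ᶠ y) *ᶠ z                                ≡⟨ cong ((x *ᶠ y) *ᶠ_) (toℕ-mod-inverse z) ⟨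
      (x *ᶠ y) *ᶠ (toℕ z mod n)                    ≡⟨ mod-* (toℕ x * toℕ y) (toℕ z) ⟩
      (toℕ x * toℕ y * toℕ z) mod n                ≡⟨ cong (_mod n) (ℕ.*-assoc (toℕ x) (toℕ y) (toℕ z)) ⟩
      (toℕ x * (toℕ y * toℕ z)) mod n              ≡⟨ mod-* (toℕ x) (toℕ y * toℕ z) ⟨
      (toℕ x mod n) *ᶠ (y *ᶠ z)                    ≡⟨ cong (_*ᶠ (y *ᶠ z)) (toℕ-mod-inverse x) ⟩
      x *ᶠ (y *ᶠ z)                                ∎

    +ᶠ-identityˡ : LeftIdentity _≡_ (0 mod n) _+ᶠ_
    +ᶠ-identityˡ x = begin
      (0 mod n) +ᶠ x              ≡⟨ cong ((0 mod n) +ᶠ_) (toℕ-mod-inverse x) ⟨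
      (0 mod n) +ᶠ (toℕ x mod n)  ≡⟨ mod-+ 0 (toℕ x) ⟩
      toℕ x mod n                 ≡⟨ toℕ-mod-inverse x ⟩
      x                           ∎

    *ᶠ-identityˡ : LeftIdentity _≡_ (1 mod n) _*ᶠ_
    *ᶠ-identityˡ x = begin
      (1 mod n) *ᶠ x              ≡⟨ cong ((1 mod n) *ᶠ_) (toℕ-mod-inverse x) ⟨
      (1 mod n) *ᶠ (toℕ x mod n)  ≡⟨ mod-* 1 (toℕ x) ⟩
      (1 * toℕ x) mod n           ≡⟨ cong (_mod n) (ℕ.*-identityˡ (toℕ x)) ⟩
      toℕ x mod n                 ≡⟨ toℕ-mod-inverse x ⟩
      x                           ∎

    -ᶠ-inverseˡ : LeftInverse _≡_ (0 mod n) -ᶠ_ _+ᶠ_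
    -ᶠ-inverseˡ x = begin
      (-ᶠ x) +ᶠ x                  ≡⟨ cong ((-ᶠ x) +ᶠ_) (toℕ-mod-inverse x) ⟨
      (-ᶠ x) +ᶠ (toℕ x mod n)      ≡⟨ mod-+ (n ∸ toℕ x) (toℕ x) ⟩
      (n ∸ toℕ x + toℕ x) mod n    ≡⟨ cong (_mod n) (ℕ.m∸n+n≡m (ℕ.<⇒≤ (Fin.toℕ<n x))) ⟩
      n mod n                      ≡⟨ mod-cong (trans (n%n≡0 n) (sym (m<n⇒m%n≡m (ℕ.>-nonZero⁻¹ n)))) ⟩
      0 mod n                      ∎

    *ᶠ-distribˡ : _DistributesOverˡ_ _≡_ _*ᶠ_ _+ᶠ_
    *ᶠ-distribˡ x y z = begin
      x *ᶠ (y +ᶠ z)                            ≡⟨ cong (_*ᶠ (y +ᶠ z)) (toℕ-mod-inverse x) ⟨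
      (toℕ x mod n) *ᶠ (y +ᶠ z)                ≡⟨ mod-* (toℕ x) (toℕ y + toℕ z) ⟩
      (toℕ x * (toℕ y + toℕ z)) mod n          ≡⟨ cong (_mod n) (ℕ.*-distribˡ-+ (toℕ x) (toℕ y) (toℕ z)) ⟩
      (toℕ x * toℕ y + toℕ x * toℕ z) mod n    ≡⟨ mod-+ (toℕ x * toℕ y) (toℕ x * toℕ z) ⟨
      (x *ᶠ y) +ᶠ (x *ᶠ z)                     ∎

  commutativeRing : CommutativeRing 0ℓ 0ℓ
  commutativeRing = mkCommutativeRing (0 mod n) (1 mod n) ≡.isEquivalence
    (cong₂ _+ᶠ_) (cong -ᶠ_) (cong₂ _*ᶠ_)
    +ᶠ-assoc (λ x y → cong (_mod n) (ℕ.+-comm (toℕ x) (toℕ y))) +ᶠ-identityˡ -ᶠ-inverseˡ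
    *ᶠ-assoc (λ x y → cong (_mod n) (ℕ.*-comm (toℕ x) (toℕ y))) *ᶠ-identityˡ *ᶠ-distribˡ

module 𝔽 {p : ℕ} (p-prime : Prime p) where

  private
    instance
      p-nonZero : NonZero p
      p-nonZero = prime⇒nonZero p-prime

  open Modular p public using (commutativeRing; mod-+; mod-*; toℕ-mod; toℕ-mod-inverse; mod-cong)
  open CommutativeRing commutativeRing public
  open RawSemiringDefs (Semiring.rawSemiring semiring) public using (_^_; sum; product)
  open Units commutativeRing public

  open ≡.≡-Reasoning
  open RingProperties ring using (-‿distribʳ-*; +-inverseˡ-unique)

  opaque

    invert : ∀ x → x ≢ 0# → ∃ λ y → x * y ≡ 1#
    invert x x≢0 = go (coprime-Bézout (prime⇒coprime p-prime {{ℕ.≢-nonZero tx≢0}} (Fin.toℕ<n x)))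
      where
      tx≢0 : toℕ x ≢ 0
      tx≢0 eq = x≢0 (≡.trans (≡.sym (toℕ-mod-inverse x)) (≡.cong (λ a → a mod p) eq))

      x*mod : ∀ b → x * (b mod p) ≡ (b ℕ.* toℕ x) mod p
      x*mod b = begin
        x * (b mod p)              ≡⟨ ≡.cong (_* (b mod p)) (toℕ-mod-inverse x) ⟨
        (toℕ x mod p) * (b mod p)  ≡⟨ mod-* (toℕ x) b ⟩
        (toℕ x ℕ.* b) mod p        ≡⟨ ≡.cong (λ a → a mod p) (ℕ.*-comm (toℕ x) b) ⟩
        (b ℕ.* toℕ x) mod p        ∎

      go : Bézout.Identity 1 p (toℕ x) → ∃ λ y → x * y ≡ 1#
      go (Bézout.-+ a b eq) = b mod p , (begin
        x * (b mod p)          ≡⟨ x*mod b ⟩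
        (b ℕ.* toℕ x) mod p    ≡⟨ ≡.cong (λ c → c mod p) eq ⟨
        (1 ℕ.+ a ℕ.* p) mod p  ≡⟨ mod-cong ([m+kn]%n≡m%n 1 a p) ⟩
        1#                     ∎)
      go (Bézout.+- a b eq) = - (b mod p) , (begin
        x * - (b mod p)    ≡⟨ -‿distribʳ-* x (b mod p) ⟨
        - (x * (b mod p))  ≡⟨ +-inverseˡ-unique 1# (x * (b mod p)) (begin
            1# + x * (b mod p)              ≡⟨ ≡.cong (λ u → 1# + u) (x*mod b) ⟩
            1# + ((b ℕ.* toℕ x) mod p)      ≡⟨ mod-+ 1 (b ℕ.* toℕ x) ⟩
            (1 ℕ.+ b ℕ.* toℕ x) mod p       ≡⟨ ≡.cong (λ c → c mod p) eq ⟩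
            (a ℕ.* p) mod p                 ≡⟨ mod-cong ([m+kn]%n≡m%n 0 a p) ⟩
            0#                              ∎) ⟨
        1#                 ∎)

------------------------------------------------------------------------
-- Multiplicative characters

module _ {p : ℕ} (p-prime : Prime p) where

  private
    module 𝔽ₚ = 𝔽 p-prime

  open Units ℂ-commutativeRing using (val) renaming (unitGroup to ℂˣ)

  characterGroup : AbelianGroup 0ℓ 0ℓ
  characterGroup = Hom.homGroup (AbelianGroup.group 𝔽ₚ.unitGroup) ℂˣ

  Character : Set
  Character = AbelianGroup.Carrier characterGroup

  open AbelianGroup characterGroup using (_∙_; _⁻¹)

  extend : Character → (x : Fin p) → Dec (x ≡ 𝔽ₚ.0#) → ℂ
  extend χ x (yes _)  = ℂ.0#
  extend χ x (no x≢0) =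
    let (y , xy≡1) = 𝔽ₚ.invert x x≢0
    in val (GroupHomomorphism.⟦_⟧ χ (𝔽ₚ.unit x y xy≡1))

  infix 9 _⟨_⟩

  -- χ(0) = 0 for every χ, the trivial character included.
  _⟨_⟩ : Character → Fin p → ℂ
  χ ⟨ x ⟩ = extend χ x (x Fin.≟ 𝔽ₚ.0#)

  ℙD : ∀ {n} (A : Character) (B : Vector Character n) (C : Character) →
       Vector (Fin p) n → ℂ
  ℙD A B C λs = ℂ.sum λ y →
    A ⟨ y ⟩ ℂ.* (C ∙ A ⁻¹) ⟨ 𝔽ₚ.1# 𝔽ₚ.- y ⟩ ℂ.*
    ℂ.product (λ r → (B r ⁻¹) ⟨ 𝔽ₚ.1# 𝔽ₚ.- λs r 𝔽ₚ.* y ⟩)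

------------------------------------------------------------------------
-- Generalized Picard curves

  picardPolynomial : ∀ {n} (i j : ℕ) → Vector ℕ n → Vector (Fin p) n → Fin p → Fin p
  picardPolynomial i j k λs x =
    x 𝔽ₚ.^ i 𝔽ₚ.* (𝔽ₚ.1# 𝔽ₚ.- x) 𝔽ₚ.^ j 𝔽ₚ.*
    𝔽ₚ.product (λ r → (𝔽ₚ.1# 𝔽ₚ.- λs r 𝔽ₚ.* x) 𝔽ₚ.^ k r)

  OnPicardCurve : ∀ {n} (N i j : ℕ) → Vector ℕ n → Vector (Fin p) n → Fin p × Fin p → Set
  OnPicardCurve N i j k λs (x , y) = y 𝔽ₚ.^ N ≡ picardPolynomial i j k λs x

  -- The summand 1 is the point at infinity.
  #PicardCurve : ∀ {n} (N i j : ℕ) → Vector ℕ n → Vector (Fin p) n → ℕ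
  #PicardCurve N i j k λs =
    1 ℕ.+ length (filter on-curve? (cartesianProduct (allFin p) (allFin p)))
    where
    on-curve? : Decidable (OnPicardCurve N i j k λs)
    on-curve? (x , y) = y 𝔽ₚ.^ N Fin.≟ picardPolynomial i j k λs x

{-# OPTIONS --safe #-}
module Submission where

-- Put e(a) = η(a), extended by e(0) = 0, and let r(a) be the number of y with y^N = a. The theorem
-- follows, by summing over x, from r(a) = S(a) for all a, where S(a) = Σ_{m<N} e(a)^m with 0^0 = 1.
-- If a ≠ 0 and e(a) = 1 then S(a) = N ≥ r(a), because y^N − a has at most N roots; if a ≠ 0 and
-- e(a) ≠ 1 then S(a) = 0 = r(a), because e(y)^N = 1 makes e trivial on N-th powers; and r(0) = S(0) = 1.
-- So r ≤ S pointwise. Both sum to p over all a: for r this counts the y, for S it is orthogonality of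
-- η^m for 0 < m < N. Hence r = S, without recourse to a primitive root.
-- Whether e(a) = 1 is undecidable constructively, but equality of Cauchy reals is ¬¬-stable.

open import Defs
open import Algebra.Bundles using (AbelianGroup; CommutativeRing; Semiring)
import Algebra.Definitions.RawMonoid as RawMonoidDefs
import Algebra.Definitions.RawSemiring as RawSemiringDefs
open import Algebra.Morphism.Bundles using (module GroupHomomorphism)
import Algebra.Properties.CommutativeMonoid.Sum as CommutativeMonoidSum
import Algebra.Properties.CommutativeSemigroup as CommutativeSemigroupProperties
import Algebra.Properties.CommutativeSemiring.Exp as CommutativeSemiringExp
import Algebra.Properties.Monoid.Mult as MonoidMult
import Algebra.Properties.Monoid.Sum as MonoidSum
import Algebra.Properties.Ring as RingProperties
import Algebra.Properties.Semiring.Exp as SemiringExp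
import Algebra.Properties.Semiring.Sum as SemiringSum
import Algebra.Solver.Ring.NaturalCoefficients.Default as SemiringSolver
open import Data.Bool.Base using (if_then_else_)
open import Data.Fin.Base using (Fin; zero; suc; toℕ)
open import Data.Fin.Permutation using (Permutation; permutation)
import Data.Fin.Properties as Fin
open import Data.Integer.Base using (+_; -_)
open import Data.List.Base using (List; []; _∷_; _++_; allFin; cartesianProduct; filter; length; map; tabulate)
import Data.List.Properties as List
open import Data.List.Relation.Unary.All as All using (All; []; _∷_)
import Data.List.Relation.Unary.All.Properties as All
open import Data.List.Relation.Unary.AllPairs using ([]; _∷_)
open import Data.List.Relation.Unary.Unique.Propositional using (Unique)
import Data.List.Relation.Unary.Unique.Propositional.Properties as Unique
open import Data.Nat.Base as ℕ using (ℕ; zero; suc)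
import Data.Nat.DivMod as ℕ
open import Data.Nat.Primality using (Prime; prime⇒nonTrivial; prime⇒nonZero)
import Data.Nat.Properties as ℕ
open import Data.Product.Base using (∃; _×_; _,_; proj₁; proj₂)
open import Data.Rational.Base as Rat using (ℚ; 0ℚ; 1ℚ; ½; ∣_∣)
import Data.Rational.Properties as Rat
open import Data.Rational.Solver using (module +-*-Solver)
open import Data.Sum.Base using (_⊎_; inj₁; inj₂; [_,_]′)
open import Data.Vec.Functional using (Vector)
open import Effect.Monad using (RawMonad)
open import Function.Base using (_∘_)
open import Relation.Binary.PropositionalEquality as ≡ using (_≡_; _≢_)
import Relation.Binary.Reasoning.Setoid as SetoidReasoning
open import Relation.Nullary using (¬_; Dec; yes; no; does; contradiction)
open import Relation.Nullary.Decidable using (¬¬-excluded-middle)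
open import Relation.Nullary.Negation using (¬¬-map; ¬¬-Monad)
open import Relation.Unary using (Decidable)

-- Equality and zero divisors in ℝ

module ℝ where

  open CommutativeRing Real.ℝ-commutativeRing public
  open RingProperties ring public using (x∙y⁻¹≈ε⇒x≈y; x≈y⇒x∙y⁻¹≈ε)
  open RawSemiringDefs (Semiring.rawSemiring semiring) public using () renaming (_×_ to _×ⁿ_)
  open Defs.Real using (ℝ; seq; cauchy; mk≈; half; halves; ∣+∣<½; restore; <-+ʳ; _+ᴿ_; _*ᴿ_; constᴿ)
  open import Data.Rational.Base using (_≤_; _<_)
  open Rat.≤-Reasoning

  fromℕ : ℕ → ℚ
  fromℕ n = RawMonoidDefs._×_ Rat.+-0-rawMonoid n 1ℚ

  -- `BoundedAway` is apartness from 0: it carries a positive δ, which `¬ x ≈ 0#` does not, and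
  -- cancelling x from a product needs that δ.
  Null BoundedAway : ℝ → Set
  Null x = ∀ {ε} → 0ℚ < ε → ∃ λ M → ∀ {n} → M ℕ.≤ n → ∣ seq x n ∣ < ε
  BoundedAway x = ∃ λ δ → 0ℚ < δ × (∃ λ M → ∀ {n} → M ℕ.≤ n → δ ≤ ∣ seq x n ∣)

  opaque
    unfolding constᴿ

    null⇒≈0 : ∀ x → Null x → x ≈ 0#
    null⇒≈0 x e = mk≈ λ {ε} 0<ε → let (M , b) = e 0<ε in
      M , λ {n} l → ≡.subst (λ q → ∣ q ∣ < ε) (≡.sym (Rat.+-identityʳ (seq x n))) (b l)

    ≈0⇒null : ∀ x → x ≈ 0# → Null x
    ≈0⇒null x (mk≈ e) {ε} 0<ε = let (M , b) = e 0<ε in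
      M , λ {n} l → ≡.subst (λ q → ∣ q ∣ < ε) (Rat.+-identityʳ (seq x n)) (b l)

  -- Only one rational comparison is made, of the term at the Cauchy modulus for ε/4 with ε/2. If
  -- that term is below ε/2, all later terms stay below ε; if not, no later term can fall below ε/4.
  small⊎boundedAway : ∀ x {ε} → 0ℚ < ε →
    (∃ λ M → ∀ {n} → M ℕ.≤ n → ∣ seq x n ∣ < ε) ⊎ BoundedAway x
  small⊎boundedAway x {ε} 0<ε = decide (cauchy x 0<ε/4)
    where
    ε/2 = ½ Rat.* ε
    ε/4 = ½ Rat.* ε/2
    0<ε/4 : 0ℚ < ε/4
    0<ε/4 = half (half 0<ε)
    ε/4<ε/2 : ε/4 < ε/2
    ε/4<ε/2 = begin-strict
      ε/4            <⟨ <-+ʳ ε/4 ε/4 0<ε/4 ⟩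
      ε/4 Rat.+ ε/4  ≡⟨ halves ε/2 ⟩
      ε/2            ∎
    decide : (∃ λ M → ∀ {m n} → M ℕ.≤ m → M ℕ.≤ n → ∣ seq x m Rat.- seq x n ∣ < ε/4) →
             (∃ λ M → ∀ {n} → M ℕ.≤ n → ∣ seq x n ∣ < ε) ⊎ BoundedAway x
    decide (M , c) = compare (∣ seq x M ∣ Rat.<? ε/2)
      where
      compare : Dec (∣ seq x M ∣ < ε/2) → _
      compare (yes small) = inj₁ (M , λ {n} l → begin-strict
        ∣ seq x n ∣                                ≡⟨ ≡.cong ∣_∣ (restore (seq x n) (seq x M)) ⟩
        ∣ (seq x n Rat.- seq x M) Rat.+ seq x M ∣
          <⟨ ∣+∣<½ (Rat.<-trans (c l ℕ.≤-refl) ε/4<ε/2) small ⟩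
        ε                                          ∎)
      compare (no ¬small) = inj₂ (ε/4 , 0<ε/4 , M , λ {n} l → Rat.≮⇒≥ λ small → ¬small (begin-strict
        ∣ seq x M ∣                                ≡⟨ ≡.cong ∣_∣ (restore (seq x M) (seq x n)) ⟩
        ∣ (seq x M Rat.- seq x n) Rat.+ seq x n ∣  <⟨ ∣+∣<½ (c ℕ.≤-refl l) small ⟩
        ε/2                                        ∎))

  boundedAway⇒≉0 : ∀ x → BoundedAway x → ¬ x ≈ 0#
  boundedAway⇒≉0 x (δ , 0<δ , M , away) x≈0 =
    let (M′ , small) = ≈0⇒null x x≈0 0<δ in
    Rat.<-irrefl ≡.refl (Rat.<-≤-trans (small (ℕ.m≤n⊔m M M′)) (away (ℕ.m≤m⊔n M M′)))

  -- The dichotomy is applied at every ε, with its second alternative excluded.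
  ¬boundedAway⇒≈0 : ∀ x → ¬ BoundedAway x → x ≈ 0#
  ¬boundedAway⇒≈0 x ¬away = null⇒≈0 x λ 0<ε → small 0<ε
    where
    small : Null x
    small 0<ε with small⊎boundedAway x 0<ε
    ... | inj₁ s    = s
    ... | inj₂ away = contradiction away ¬away

  -- Apartness of x - y from 0 refutes `x ≈ y`, so the double negation excludes apartness, and what
  -- is not apart from 0 equals 0.
  ≈-stable : ∀ x y → ¬ ¬ x ≈ y → x ≈ y
  ≈-stable x y ¬¬x≈y = x∙y⁻¹≈ε⇒x≈y x y (¬boundedAway⇒≈0 (x - y) λ away →
    ¬¬x≈y λ x≈y → boundedAway⇒≉0 (x - y) away (x≈y⇒x∙y⁻¹≈ε x≈y))

  ∣p∣²≡p² : ∀ p → ∣ p ∣ Rat.* ∣ p ∣ ≡ p Rat.* p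
  ∣p∣²≡p² p = [ (λ eq → ≡.cong₂ Rat._*_ eq eq) , (λ eq → ≡.trans (≡.cong₂ Rat._*_ eq eq) (-p² p)) ]′
    (Rat.∣p∣≡p∨∣p∣≡-p p)
    where
    open +-*-Solver
    -p² : ∀ p → (Rat.- p) Rat.* (Rat.- p) ≡ p Rat.* p
    -p² = solve 1 (λ p → (:- p) :* (:- p) := p :* p) ≡.refl

  0≤p² : ∀ p → 0ℚ ≤ p Rat.* p
  0≤p² p = begin
    0ℚ                   ≡⟨ Rat.*-zeroʳ ∣ p ∣ ⟨
    ∣ p ∣ Rat.* 0ℚ       ≤⟨ Rat.*-monoˡ-≤-nonNeg ∣ p ∣ {{Rat.∣-∣-nonNeg p}} (Rat.0≤∣p∣ p) ⟩
    ∣ p ∣ Rat.* ∣ p ∣    ≡⟨ ∣p∣²≡p² p ⟩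
    p Rat.* p            ∎

  opaque
    unfolding _*ᴿ_ _+ᴿ_

    -- Eventually δ ∣yₙ∣ ≤ ∣xₙ yₙ∣ < δ ε, and the rational δ can be cancelled.
    boundedAway-cancel : ∀ x y → BoundedAway x → x * y ≈ 0# → y ≈ 0#
    boundedAway-cancel x y (δ , 0<δ , M , away) xy≈0 = null⇒≈0 y λ 0<ε → small 0<ε
      where
      instance
        δ-pos : Rat.Positive δ
        δ-pos = Rat.positive 0<δ
      small : Null y
      small {ε} 0<ε = let (M′ , b) = ≈0⇒null (x * y) xy≈0 0<δε in M ℕ.⊔ M′ , λ {n} l →
        Rat.*-cancelˡ-<-nonNeg δ {{Rat.pos⇒nonNeg δ}} (begin-strict
          δ Rat.* ∣ seq y n ∣            ≤⟨ Rat.*-monoʳ-≤-nonNeg ∣ seq y n ∣ {{Rat.∣-∣-nonNeg (seq y n)}}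
                                             (away (ℕ.m⊔n≤o⇒m≤o M M′ l)) ⟩
          ∣ seq x n ∣ Rat.* ∣ seq y n ∣  ≡⟨ Rat.∣p*q∣≡∣p∣*∣q∣ (seq x n) (seq y n) ⟨
          ∣ seq x n Rat.* seq y n ∣      <⟨ b (ℕ.m⊔n≤o⇒n≤o M M′ l) ⟩
          δ Rat.* ε                      ∎)
        where
        0<δε : 0ℚ < δ Rat.* ε
        0<δε = ≡.subst (_< δ Rat.* ε) (Rat.*-zeroʳ δ) (Rat.*-monoʳ-<-pos δ 0<ε)

    -- The square of y only adds a nonnegative amount, so δ² bounds the sum from below.
    boundedAway-+² : ∀ x y → BoundedAway x → BoundedAway (x * x + y * y)
    boundedAway-+² x y (δ , 0<δ , M , away) = δ Rat.* δ , 0<δ² , M , λ {n} l → begin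
      δ Rat.* δ                      ≤⟨ Rat.*-monoˡ-≤-nonNeg δ (away l) ⟩
      δ Rat.* ∣ seq x n ∣            ≤⟨ Rat.*-monoʳ-≤-nonNeg ∣ seq x n ∣ {{Rat.∣-∣-nonNeg (seq x n)}} (away l) ⟩
      ∣ seq x n ∣ Rat.* ∣ seq x n ∣  ≡⟨ ∣p∣²≡p² (seq x n) ⟩
      seq x n Rat.* seq x n          ≡⟨ Rat.+-identityʳ _ ⟨
      seq x n Rat.* seq x n Rat.+ 0ℚ ≤⟨ Rat.+-monoʳ-≤ (seq x n Rat.* seq x n) (0≤p² (seq y n)) ⟩
      seq x n Rat.* seq x n Rat.+ seq y n Rat.* seq y n
        ≡⟨ Rat.0≤p⇒∣p∣≡p (Rat.+-mono-≤ (0≤p² (seq x n)) (0≤p² (seq y n))) ⟨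
      ∣ seq x n Rat.* seq x n Rat.+ seq y n Rat.* seq y n ∣ ∎
      where
      instance
        δ-pos : Rat.Positive δ
        δ-pos = Rat.positive 0<δ
        δ-nonNeg : Rat.NonNegative δ
        δ-nonNeg = Rat.pos⇒nonNeg δ
      0<δ² : 0ℚ < δ Rat.* δ
      0<δ² = ≡.subst (_< δ Rat.* δ) (Rat.*-zeroʳ δ) (Rat.*-monoʳ-<-pos δ 0<δ)

  -- Since `x` is merely unequal to 0, no δ is at hand. Stability allows assuming `y` nonzero; then
  -- `x` cannot be bounded away from 0, hence is 0, a contradiction.
  noZeroDivisors : ∀ x y → x * y ≈ 0# → ¬ x ≈ 0# → y ≈ 0#
  noZeroDivisors x y xy≈0 x≉0 = ≈-stable y 0# λ y≉0 →
    x≉0 (¬boundedAway⇒≈0 x λ away → y≉0 (boundedAway-cancel x y away xy≈0))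

  x²+y²≈0⇒x≈0 : ∀ x y → x * x + y * y ≈ 0# → x ≈ 0#
  x²+y²≈0⇒x≈0 x y eq = ¬boundedAway⇒≈0 x λ away →
    boundedAway⇒≉0 _ (boundedAway-+² x y away) eq

  fromℕ-nonNeg : ∀ n → 0ℚ ≤ fromℕ n
  fromℕ-nonNeg zero    = Rat.≤-refl
  fromℕ-nonNeg (suc n) = Rat.+-mono-≤ (Rat.<⇒≤ (Rat.positive⁻¹ 1ℚ)) (fromℕ-nonNeg n)

  opaque
    unfolding _+ᴿ_ constᴿ

    seq-×ⁿ : ∀ n t → seq (n ×ⁿ 1#) t ≡ fromℕ n
    seq-×ⁿ zero    t = ≡.refl
    seq-×ⁿ (suc n) t = ≡.cong (1ℚ Rat.+_) (seq-×ⁿ n t)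

  -- Characteristic 0: the sequence is constant with value at least 1, so 1 serves as δ.
  1+n×1≉0 : ∀ n → ¬ (suc n ×ⁿ 1#) ≈ 0#
  1+n×1≉0 n = boundedAway⇒≉0 (suc n ×ⁿ 1#) (1ℚ , Rat.positive⁻¹ 1ℚ , 0 , λ {t} _ → begin
    1ℚ                          ≡⟨ Rat.+-identityʳ 1ℚ ⟨
    1ℚ Rat.+ 0ℚ                 ≤⟨ Rat.+-monoʳ-≤ 1ℚ (fromℕ-nonNeg n) ⟩
    1ℚ Rat.+ fromℕ n            ≡⟨ Rat.0≤p⇒∣p∣≡p (fromℕ-nonNeg (suc n)) ⟨
    ∣ 1ℚ Rat.+ fromℕ n ∣        ≡⟨ ≡.cong ∣_∣ (seq-×ⁿ (suc n) t) ⟨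
    ∣ seq (suc n ×ⁿ 1#) t ∣     ∎)

-- Geometric sums in ℂ

module ℂᵖ where

  open ℂ hiding (zero)
  open Gaussian Real.ℝ-commutativeRing using (re; im; re≈; im≈; _+i_; _,_)

  ≈-stable : ∀ z w → ¬ ¬ z ≈ w → z ≈ w
  ≈-stable z w h = ℝ.≈-stable _ _ (¬¬-map re≈ h) , ℝ.≈-stable _ _ (¬¬-map im≈ h)

  -- Multiplying z w = 0 by the conjugate of z gives ∣z∣² w = 0, which reduces each coordinate of w
  -- to the real case. In coordinates the hypothesis reads ca = db and cb + da = 0.
  noZeroDivisors : ∀ z w → z * w ≈ 0# → ¬ z ≈ 0# → w ≈ 0#
  noZeroDivisors z@(c +i d) w@(a +i b) (re≈0 , im≈0) z≉0 =
    ℝ.noZeroDivisors ∣z∣² a (begin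
      ∣z∣² ℝ.* a
        ≈⟨ solve 3 (λ a c d → (c :* c :+ d :* d) :* a := c :* (c :* a) :+ d :* (d :* a)) ℝ.refl a c d ⟩
      c ℝ.* (c ℝ.* a) ℝ.+ d ℝ.* (d ℝ.* a)     ≈⟨ ℝ.+-congʳ (ℝ.*-congˡ ca≈db) ⟩
      c ℝ.* (d ℝ.* b) ℝ.+ d ℝ.* (d ℝ.* a)
        ≈⟨ solve 4 (λ a b c d → c :* (d :* b) :+ d :* (d :* a) := d :* (c :* b :+ d :* a)) ℝ.refl a b c d ⟩
      d ℝ.* (c ℝ.* b ℝ.+ d ℝ.* a)             ≈⟨ ℝ.*-congˡ im≈0 ⟩
      d ℝ.* ℝ.0#                              ≈⟨ ℝ.zeroʳ d ⟩
      ℝ.0#                                    ∎) ∣z∣²≉0 ,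
    ℝ.noZeroDivisors ∣z∣² b (begin
      ∣z∣² ℝ.* b
        ≈⟨ solve 3 (λ b c d → (c :* c :+ d :* d) :* b := c :* (c :* b) :+ d :* (d :* b)) ℝ.refl b c d ⟩
      c ℝ.* (c ℝ.* b) ℝ.+ d ℝ.* (d ℝ.* b)     ≈⟨ ℝ.+-congˡ (ℝ.*-congˡ ca≈db) ⟨
      c ℝ.* (c ℝ.* b) ℝ.+ d ℝ.* (c ℝ.* a)
        ≈⟨ solve 4 (λ a b c d → c :* (c :* b) :+ d :* (c :* a) := c :* (c :* b :+ d :* a)) ℝ.refl a b c d ⟩
      c ℝ.* (c ℝ.* b ℝ.+ d ℝ.* a)             ≈⟨ ℝ.*-congˡ im≈0 ⟩
      c ℝ.* ℝ.0#                              ≈⟨ ℝ.zeroʳ c ⟩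
      ℝ.0#                                    ∎) ∣z∣²≉0
    where
    open SetoidReasoning ℝ.setoid
    open SemiringSolver ℝ.commutativeSemiring
    ∣z∣² = c ℝ.* c ℝ.+ d ℝ.* d
    ca≈db : c ℝ.* a ℝ.≈ d ℝ.* b
    ca≈db = ℝ.x∙y⁻¹≈ε⇒x≈y _ _ re≈0
    ∣z∣²≉0 : ¬ ∣z∣² ℝ.≈ ℝ.0#
    ∣z∣²≉0 eq = z≉0 (ℝ.x²+y²≈0⇒x≈0 c d eq , ℝ.x²+y²≈0⇒x≈0 d c (ℝ.trans (ℝ.+-comm _ _) eq))

  re-fromℕ : ∀ n → re (fromℕ n) ≡ n ℝ.×ⁿ ℝ.1#
  re-fromℕ zero    = ≡.refl
  re-fromℕ (suc n) = ≡.cong (ℝ.1# ℝ.+_) (re-fromℕ n)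

  fromℕ-suc≉0 : ∀ n → ¬ fromℕ (suc n) ≈ 0#
  fromℕ-suc≉0 n (re≈0 , _) = ℝ.1+n×1≉0 n (≡.subst (ℝ._≈ ℝ.0#) (re-fromℕ (suc n)) re≈0)

  open RingProperties ring using (+-cancelˡ; x∙y⁻¹≈ε⇒x≈y; [y-z]x≈yx-zx)

  -- This brings an identity between counts, proved with complex character sums, back to ℕ.
  fromℕ-injective : ∀ m n → fromℕ m ≈ fromℕ n → m ≡ n
  fromℕ-injective zero    zero    _  = ≡.refl
  fromℕ-injective zero    (suc n) eq = contradiction (sym eq) (fromℕ-suc≉0 n)
  fromℕ-injective (suc m) zero    eq = contradiction eq (fromℕ-suc≉0 m)
  fromℕ-injective (suc m) (suc n) eq = ≡.cong suc (fromℕ-injective m n (+-cancelˡ 1# _ _ eq))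

  open MonoidMult +-monoid public using () renaming (×-homo-+ to ×ⁿ-homo-+)
  open SemiringSum semiring public
    using (sum-cong-≋; *-distribˡ-sum; sum-permute; ∑-comm; ∑-distrib-+; sum-replicate; sum-replicate-zero)
  open SemiringExp semiring public using (^-congˡ; ^-assocʳ; ^-homo-*)
  open CommutativeSemiringExp commutativeSemiring public using (^-distrib-*)
  module Nat = CommutativeMonoidSum ℕ.+-0-commutativeMonoid

  fromℕ-sum : ∀ {n} (f : Fin n → ℕ) → fromℕ (Nat.sum f) ≈ sum (fromℕ ∘ f)
  fromℕ-sum {zero}  f = refl
  fromℕ-sum {suc n} f = trans (×ⁿ-homo-+ 1# (f zero) _) (+-congˡ (fromℕ-sum (f ∘ suc)))

  -- Here (x - 1) y = 0. Both the vanishing of geometric sums and orthogonality of characters come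
  -- from such an invariance.
  xy≈y⇒y≈0 : ∀ x y → x * y ≈ y → ¬ x ≈ 1# → y ≈ 0#
  xy≈y⇒y≈0 x y xy≈y x≉1 = noZeroDivisors (x - 1#) y
    (trans ([y-z]x≈yx-zx y x 1#) (trans (+-cong xy≈y (-‿cong (*-identityˡ y))) (-‿inverseʳ y)))
    λ x-1≈0 → x≉1 (x∙y⁻¹≈ε⇒x≈y x 1# x-1≈0)

  1^n≈1 : ∀ n → 1# ^ n ≈ 1#
  1^n≈1 zero    = refl
  1^n≈1 (suc n) = trans (*-identityˡ _) (1^n≈1 n)

  product-cong : ∀ {n} {f g : Fin n → Carrier} → (∀ i → f i ≈ g i) → product f ≈ product g
  product-cong f≈g = MonoidSum.sum-cong-≋ *-monoid f≈g

  product-^ : ∀ {n} (f : Fin n → Carrier) m → product f ^ m ≈ product (λ i → f i ^ m)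
  product-^ {zero}  f m = 1^n≈1 m
  product-^ {suc n} f m = trans (^-distrib-* (f zero) (product (f ∘ suc)) m) (*-congˡ (product-^ (f ∘ suc) m))

  geometric : ℕ → Carrier → Carrier
  geometric n z = sum {n} λ m → z ^ toℕ m

  -- The telescoping identity (z - 1) G = zⁿ - 1, with the negative terms moved across.
  z*geometric : ∀ n z → z * geometric n z + 1# ≈ geometric n z + z ^ n
  z*geometric zero z = +-congʳ (zeroʳ z)
  z*geometric (suc n) z = begin
    z * (1# + sum {n} (λ m → z * z ^ toℕ m)) + 1#
      ≈⟨ +-congʳ (*-congˡ (+-congˡ (sym (*-distribˡ-sum {n} z (λ m → z ^ toℕ m))))) ⟩
    z * (1# + z * g) + 1#       ≈⟨ +-congʳ (*-congˡ (trans (+-comm 1# _) (z*geometric n z))) ⟩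
    z * (g + z ^ n) + 1#        ≈⟨ +-comm _ 1# ⟩
    1# + z * (g + z ^ n)        ≈⟨ +-congˡ (distribˡ z g (z ^ n)) ⟩
    1# + (z * g + z ^ suc n)    ≈⟨ +-assoc 1# (z * g) (z ^ suc n) ⟨
    1# + z * g + z ^ suc n      ≈⟨ +-congʳ (+-congˡ (*-distribˡ-sum {n} z (λ m → z ^ toℕ m))) ⟩
    geometric (suc n) z + z ^ suc n ∎
    where
    open SetoidReasoning setoid
    g = geometric n z

  geometric-cong : ∀ n {z w} → z ≈ w → geometric n z ≈ geometric n w
  geometric-cong n z≈w = sum-cong-≋ λ m → ^-congˡ (toℕ {n} m) z≈w

  geometric-1 : ∀ n → geometric n 1# ≈ fromℕ n
  geometric-1 n = trans (sum-cong-≋ λ m → 1^n≈1 (toℕ {n} m)) (sum-replicate n)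

  -- Only the exponent 0 contributes, as 0^0 = 1; this matches the single root of y^N = 0.
  geometric-0 : ∀ n → geometric (suc n) 0# ≈ 1#
  geometric-0 n = trans
    (+-congˡ (trans (sum-cong-≋ λ m → zeroˡ (0# ^ toℕ {n} m)) (sum-replicate-zero n)))
    (+-identityʳ 1#)

  geometric-root : ∀ n z → z ^ n ≈ 1# → ¬ z ≈ 1# → geometric n z ≈ 0#
  geometric-root n z z^n≈1 = xy≈y⇒y≈0 z (geometric n z)
    (+-cancelʳ 1# _ _ (trans (z*geometric n z) (+-congˡ z^n≈1)))
    where open RingProperties ring using (+-cancelʳ)

-- Counting

𝟏[_] : ∀ {a} {A : Set a} → Dec A → ℕ
𝟏[ a? ] = if does a? then 1 else 0

module _ {a p} {A : Set a} {P : A → Set p} (P? : Decidable P) where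

  open ℂᵖ.Nat using (sum)

  length-filter-tabulate : ∀ {n} (f : Fin n → A) → length (filter P? (tabulate f)) ≡ sum (λ i → 𝟏[ P? (f i) ])
  length-filter-tabulate {zero}  f = ≡.refl
  length-filter-tabulate {suc n} f with P? (f zero)
  ... | yes _ = ≡.cong suc (length-filter-tabulate (f ∘ suc))
  ... | no  _ = length-filter-tabulate (f ∘ suc)

  length-filter-map : ∀ {b} {B : Set b} (f : B → A) xs → length (filter P? (map f xs)) ≡ length (filter (P? ∘ f) xs)
  length-filter-map f []       = ≡.refl
  length-filter-map f (x ∷ xs) with P? (f x)
  ... | yes _ = ≡.cong suc (length-filter-map f xs)
  ... | no  _ = length-filter-map f xs

module _ {a b p} {A : Set a} {B : Set b} {P : A × B → Set p} (P? : Decidable P) where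

  open ℂᵖ.Nat using (sum)
  open ≡.≡-Reasoning

  length-filter-cartesianProduct : ∀ {n} (f : Fin n → A) (ys : List B) →
    length (filter P? (cartesianProduct (tabulate f) ys)) ≡ sum λ i → length (filter (λ y → P? (f i , y)) ys)
  length-filter-cartesianProduct {zero}  f ys = ≡.refl
  length-filter-cartesianProduct {suc n} f ys = begin
    length (filter P? (map (f zero ,_) ys ++ rest))
      ≡⟨ ≡.cong length (List.filter-++ P? (map (f zero ,_) ys) rest) ⟩
    length (filter P? (map (f zero ,_) ys) ++ filter P? rest)
      ≡⟨ List.length-++ (filter P? (map (f zero ,_) ys)) ⟩
    length (filter P? (map (f zero ,_) ys)) ℕ.+ length (filter P? rest)
      ≡⟨ ≡.cong₂ ℕ._+_ (length-filter-map P? (f zero ,_) ys) (length-filter-cartesianProduct (f ∘ suc) ys) ⟩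
    _ ∎
    where rest = cartesianProduct (tabulate (f ∘ suc)) ys

module _ where

  open ℂᵖ.Nat

  sum-𝟏 : ∀ {n} (b : Fin n) → sum (λ a → 𝟏[ b Fin.≟ a ]) ≡ 1
  sum-𝟏 {suc n} zero    = ≡.cong suc (sum-replicate-zero n)
  sum-𝟏         (suc b) = sum-𝟏 b

  sum-mono : ∀ {n} (f g : Fin n → ℕ) → (∀ i → f i ℕ.≤ g i) → sum f ℕ.≤ sum g
  sum-mono {zero}  f g f≤g = ℕ.z≤n
  sum-mono {suc n} f g f≤g = ℕ.+-mono-≤ (f≤g zero) (sum-mono (f ∘ suc) (g ∘ suc) (f≤g ∘ suc))

  -- A strict inequality at the head would make the whole sum strictly smaller. So the heads agree
  -- and can be cancelled.
  sum-≡⇒≗ : ∀ {n} (f g : Fin n → ℕ) → (∀ i → f i ℕ.≤ g i) → sum f ≡ sum g → ∀ i → f i ≡ g i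
  sum-≡⇒≗ {suc n} f g f≤g eq i = go i
    where
    tail≤ : sum (f ∘ suc) ℕ.≤ sum (g ∘ suc)
    tail≤ = sum-mono (f ∘ suc) (g ∘ suc) (f≤g ∘ suc)
    head≡ : f zero ≡ g zero
    head≡ = ℕ.≤∧≮⇒≡ (f≤g zero) λ lt → ℕ.<-irrefl eq (ℕ.+-mono-<-≤ lt tail≤)
    go : ∀ i → f i ≡ g i
    go zero    = head≡
    go (suc i) = sum-≡⇒≗ (f ∘ suc) (g ∘ suc) (f≤g ∘ suc)
      (ℕ.+-cancelˡ-≡ (g zero) _ _ (≡.trans (≡.cong (ℕ._+ sum (f ∘ suc)) (≡.sym head≡)) eq)) i

  -- After exchanging the two sums, each y is counted once, at a = f y.
  sum-fibres : ∀ {m n} (f : Fin m → Fin n) → sum (λ a → length (filter (λ y → f y Fin.≟ a) (allFin m))) ≡ m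
  sum-fibres {m} {n} f = begin
    sum (λ a → length (filter (λ y → f y Fin.≟ a) (allFin m)))
      ≡⟨ sum-cong-≗ (λ a → length-filter-tabulate (λ y → f y Fin.≟ a) (λ i → i)) ⟩
    sum (λ a → sum (λ y → 𝟏[ f y Fin.≟ a ]))                     ≡⟨ ∑-comm (λ a y → 𝟏[ f y Fin.≟ a ]) ⟩
    sum (λ y → sum (λ a → 𝟏[ f y Fin.≟ a ]))                     ≡⟨ sum-cong-≗ (λ y → sum-𝟏 (f y)) ⟩
    sum {m} (λ _ → 1)                                           ≡⟨ sum-1 m ⟩
    m                                                           ∎
    where
    open ≡.≡-Reasoning
    sum-1 : ∀ m → sum {m} (λ _ → 1) ≡ m
    sum-1 zero    = ≡.refl
    sum-1 (suc m) = ≡.cong suc (sum-1 m)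

-- Polynomials over 𝔽ₚ

module 𝔽ᵖ {p : ℕ} (p-prime : Prime p) where

  open 𝔽 p-prime hiding (zero) renaming (-_ to -ᶠ_)
  open RingProperties ring using ([y-z]x≈yx-zx; x∙y⁻¹≈ε⇒x≈y; x≈y⇒x∙y⁻¹≈ε)
  open ≡.≡-Reasoning

  private
    instance
      p-nonZero : ℕ.NonZero p
      p-nonZero = prime⇒nonZero p-prime

  1≢0 : 1# ≢ 0#
  1≢0 1≡0 = ℕ.1+n≢0 (begin
    1               ≡⟨ ℕ.m<n⇒m%n≡m (ℕ.nonTrivial⇒n>1 p {{prime⇒nonTrivial p-prime}}) ⟨
    1 ℕ.% p         ≡⟨ toℕ-mod 1 ⟨
    toℕ 1#          ≡⟨ ≡.cong toℕ 1≡0 ⟩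
    toℕ 0#          ≡⟨ toℕ-mod 0 ⟩
    0 ℕ.% p         ≡⟨ ℕ.m<n⇒m%n≡m (ℕ.>-nonZero⁻¹ p) ⟩
    0               ∎)

  xy≡0⇒y≡0 : ∀ {x y} → x ≢ 0# → x * y ≡ 0# → y ≡ 0#
  xy≡0⇒y≡0 {x} {y} x≢0 xy≡0 = let (x⁻¹ , xx⁻¹≡1) = invert x x≢0 in begin
    y                ≡⟨ *-identityˡ y ⟨
    1# * y           ≡⟨ ≡.cong (_* y) (≡.trans (*-comm x⁻¹ x) xx⁻¹≡1) ⟨
    x⁻¹ * x * y      ≡⟨ *-assoc x⁻¹ x y ⟩
    x⁻¹ * (x * y)    ≡⟨ ≡.cong (x⁻¹ *_) xy≡0 ⟩
    x⁻¹ * 0#         ≡⟨ zeroʳ x⁻¹ ⟩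
    0#               ∎

  xz≡yz⇒z≡0 : ∀ {x y z} → x ≢ y → x * z ≡ y * z → z ≡ 0#
  xz≡yz⇒z≡0 {x} {y} {z} x≢y eq = xy≡0⇒y≡0 (λ x-y≡0 → x≢y (x∙y⁻¹≈ε⇒x≈y x y x-y≡0))
    (≡.trans ([y-z]x≈yx-zx z x y) (x≈y⇒x∙y⁻¹≈ε eq))

  x^n≡0⇒x≡0 : ∀ n {x} → x ^ n ≡ 0# → x ≡ 0#
  x^n≡0⇒x≡0 zero    1≡0 = contradiction 1≡0 1≢0
  x^n≡0⇒x≡0 (suc n) {x} eq with x Fin.≟ 0#
  ... | yes x≡0 = x≡0
  ... | no  x≢0 = x^n≡0⇒x≡0 n (xy≡0⇒y≡0 x≢0 eq)

  0^1+n≡0 : ∀ n → 0# ^ suc n ≡ 0#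
  0^1+n≡0 n = zeroˡ (0# ^ n)

  unit≢0 : (u : Unit) → val u ≢ 0#
  unit≢0 (unit a b ab≡1) a≡0 = 1≢0 (≡.trans (≡.sym ab≡1) (≡.trans (≡.cong (_* b) a≡0) (zeroˡ b)))

  -- A Horner presentation of a function, with pointwise equations in place of function
  -- extensionality. The degree belongs to the presentation: over a finite field one function can
  -- have several.
  data Monic : ℕ → (Fin p → Fin p) → Set where
    one    : ∀ {f} → (∀ x → f x ≡ 1#) → Monic 0 f
    horner : ∀ {n f g} c → (∀ x → f x ≡ c + x * g x) → Monic n g → Monic (suc n) f

  -- f(x) − f(r) = (x − r) q(x), stated without subtraction. If g(x) − g(r) = (x − r) h(x), then
  -- x g(x) − r g(r) = (x − r) (g(r) + x h(x)), so the quotient is again in Horner form.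
  quotient : ∀ {n f} → Monic (suc n) f → ∀ r →
             ∃ λ q → Monic n q × (∀ x → f x + r * q x ≡ f r + x * q x)
  quotient {f = f} (horner {g = g} c f≡ (one g≡1)) r = (λ _ → 1#) , one (λ _ → ≡.refl) , λ x → begin
    f x + r * 1#            ≡⟨ ≡.cong (_+ r * 1#) (f≡1 x) ⟩
    c + x * 1# + r * 1#     ≡⟨ xy∙z≈xz∙y c (x * 1#) (r * 1#) ⟩
    c + r * 1# + x * 1#     ≡⟨ ≡.cong (_+ x * 1#) (f≡1 r) ⟨
    f r + x * 1#            ∎
    where
    open CommutativeSemigroupProperties +-commutativeSemigroup using (xy∙z≈xz∙y)
    f≡1 : ∀ x → f x ≡ c + x * 1#
    f≡1 x = ≡.trans (f≡ x) (≡.cong (λ y → c + x * y) (g≡1 x))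
  quotient {f = f} (horner {g = g} c f≡ g-monic@(horner _ _ _)) r =
    let (h , h-monic , g-split) = quotient g-monic r in
    (λ x → g r + x * h x) , horner (g r) (λ _ → ≡.refl) h-monic , λ x → begin
      f x + r * (g r + x * h x)                 ≡⟨ ≡.cong (_+ r * (g r + x * h x)) (f≡ x) ⟩
      c + x * g x + r * (g r + x * h x)         ≡⟨ rearrange c x r (g x) (g r) (h x) ⟩
      c + r * g r + x * (g x + r * h x)         ≡⟨ ≡.cong₂ (λ a b → a + x * b) (≡.sym (f≡ r)) (g-split x) ⟩
      f r + x * (g r + x * h x)                 ∎
    where
    open SemiringSolver commutativeSemiring
    rearrange : ∀ c x r a b d → c + x * a + r * (b + x * d) ≡ c + r * b + x * (a + r * d)
    rearrange = solve 6 (λ c x r a b d →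
      c :+ x :* a :+ r :* (b :+ x :* d) := c :+ r :* b :+ x :* (a :+ r :* d)) ≡.refl

  -- Divide by x - r for the first root r: the remaining roots differ from r, so they are roots of
  -- the quotient, of degree one less. In degree 0 the function is 1 and has no root.
  length-roots≤degree : ∀ {n f} → Monic n f → ∀ {rs} → Unique rs → All (λ x → f x ≡ 0#) rs → length rs ℕ.≤ n
  length-roots≤degree _ {[]} _ _ = ℕ.z≤n
  length-roots≤degree (one f≡1) {r ∷ rs} _ (fr≡0 ∷ _) = contradiction (≡.trans (≡.sym (f≡1 r)) fr≡0) 1≢0
  length-roots≤degree {suc n} {f} f-monic@(horner _ _ _) {r ∷ rs} (r∉rs ∷ rs!) (fr≡0 ∷ frs≡0) =
    let (q , q-monic , split) = quotient f-monic r in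
    ℕ.s≤s (length-roots≤degree q-monic rs! (All.zipWith (λ {x} → root q split x) (r∉rs , frs≡0)))
    where
    root : ∀ q → (∀ x → f x + r * q x ≡ f r + x * q x) → ∀ x → (r ≢ x) × (f x ≡ 0#) → q x ≡ 0#
    root q split x (r≢x , fx≡0) = xz≡yz⇒z≡0 r≢x (begin
      r * q x        ≡⟨ +-identityˡ _ ⟨
      0# + r * q x   ≡⟨ ≡.cong (_+ r * q x) fx≡0 ⟨
      f x + r * q x  ≡⟨ split x ⟩
      f r + x * q x  ≡⟨ ≡.cong (_+ x * q x) fr≡0 ⟩
      0# + x * q x   ≡⟨ +-identityˡ _ ⟩
      x * q x        ∎)

  ^-monic : ∀ n → Monic n (_^ n)
  ^-monic zero    = one λ _ → ≡.refl
  ^-monic (suc n) = horner 0# (λ x → ≡.sym (+-identityˡ _)) (^-monic n)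

  #roots : ℕ → Fin p → ℕ
  #roots N a = length (filter (λ y → y ^ N Fin.≟ a) (allFin p))

  #roots≤N : ∀ n a → #roots (suc n) a ℕ.≤ suc n
  -- The polynomial is y^N - a, with constant Horner coefficient -a.
  #roots≤N n a = length-roots≤degree (horner (-ᶠ a) (λ _ → ≡.refl) (^-monic n))
    (Unique.filter⁺ _ (Unique.allFin⁺ p))
    (All.map (λ {y} y^N≡a → ≡.trans (≡.cong (λ b → -ᶠ a + b) y^N≡a) (-‿inverseˡ a))
             (All.all-filter (λ y → y ^ suc n Fin.≟ a) (allFin p)))

  -- Every solution of y^n = 0 is a root of the monic y^1, whose degree is 1.
  #roots-0≤1 : ∀ n → #roots n 0# ℕ.≤ 1
  #roots-0≤1 n = length-roots≤degree (^-monic 1)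
    (Unique.filter⁺ _ (Unique.allFin⁺ p))
    (All.map (λ {y} y^n≡0 → ≡.trans (*-identityʳ y) (x^n≡0⇒x≡0 n y^n≡0))
             (All.all-filter (λ y → y ^ n Fin.≟ 0#) (allFin p)))

  #roots≡0 : ∀ n a → (∀ y → y ^ n ≢ a) → #roots n a ≡ 0
  #roots≡0 n a no-root = ≡.cong length (List.filter-none (λ y → y ^ n Fin.≟ a) (All.universal no-root (allFin p)))

-- Multiplicative characters

module _ {c ℓ} (G : AbelianGroup c ℓ) where

  open AbelianGroup G using (Carrier; _∙_; _⁻¹; ε)
  open Powers (AbelianGroup.group G) using (_^_)

  module _ (φ : Carrier → ℂ) where

    multiplicative⇒^ : φ ε ℂ.≈ ℂ.1# → (∀ x y → φ (x ∙ y) ℂ.≈ φ x ℂ.* φ y) →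
                       ∀ x n → φ (x ^ (+ n)) ℂ.≈ φ x ℂ.^ n
    multiplicative⇒^ φ-ε φ-∙ x zero    = φ-ε
    multiplicative⇒^ φ-ε φ-∙ x (suc n) =
      ℂ.trans (φ-∙ x (x ^ (+ n))) (ℂ.*-congˡ {φ x} (multiplicative⇒^ φ-ε φ-∙ x n))

    -- A negative power is by definition the inverse of a positive one, so the outer inverse makes a
    -- double inverse. This handles the inverse of each B in the period, itself a negative power of
    -- η.
    involutive⇒^-⁻¹ : (∀ x → φ ((x ⁻¹) ⁻¹) ℂ.≈ φ x) →
                      ∀ x n → φ ((x ^ (- (+ suc n))) ⁻¹) ℂ.≈ φ (x ^ (+ suc n))
    involutive⇒^-⁻¹ φ-⁻¹⁻¹ x n = φ-⁻¹⁻¹ (x ^ (+ suc n))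

module Characters {p : ℕ} (p-prime : Prime p) where

  private
    module 𝔽ₚ where
      open 𝔽 p-prime public
      open 𝔽ᵖ p-prime public
    module ℂˣ = Units ℂ-commutativeRing

  open AbelianGroup (characterGroup p-prime) using (_∙_; _⁻¹; ε; group) renaming (_≈_ to _≋_)
  open Powers group using (_^_; HasOrder)
  open CommutativeSemiringExp ℂ.commutativeSemiring using (^-distrib-*)
  open SetoidReasoning ℂ.setoid

  value : Character p-prime → 𝔽ₚ.Unit → ℂ
  value χ u = ℂˣ.val (GroupHomomorphism.⟦_⟧ χ u)

  infix 9 _⟪_⟫
  _⟪_⟫ : Character p-prime → Fin p → ℂ
  χ ⟪ x ⟫ = _⟨_⟩ p-prime χ x

  asUnit : ∀ {x} → x ≢ 𝔽ₚ.0# → 𝔽ₚ.Unit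
  asUnit {x} x≢0 = let (y , xy≡1) = 𝔽ₚ.invert x x≢0 in 𝔽ₚ.unit x y xy≡1

  ⟪0⟫ : ∀ χ {x} → x ≡ 𝔽ₚ.0# → χ ⟪ x ⟫ ℂ.≈ ℂ.0#
  ⟪0⟫ χ {x} x≡0 = go (x Fin.≟ 𝔽ₚ.0#)
    where
    -- `extend` takes the decision as an argument, so it can be generalised to an arbitrary `d`.
    go : ∀ d → extend p-prime χ x d ℂ.≈ ℂ.0#
    go (yes _)  = ℂ.refl
    go (no x≢0) = contradiction x≡0 x≢0

  -- The inverse stored in `u` need not be the one computed by `invert`, but units are compared by
  -- `val` alone, so χ cannot tell them apart.
  ⟪unit⟫ : ∀ χ u → χ ⟪ 𝔽ₚ.val u ⟫ ℂ.≈ value χ u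
  ⟪unit⟫ χ u = go (𝔽ₚ.val u Fin.≟ 𝔽ₚ.0#)
    where
    go : ∀ d → extend p-prime χ (𝔽ₚ.val u) d ℂ.≈ value χ u
    go (yes u≡0) = contradiction u≡0 (𝔽ₚ.unit≢0 u)
    go (no u≢0)  = GroupHomomorphism.⟦⟧-cong χ {asUnit u≢0} {u} ≡.refl

  ⟪1⟫ : ∀ χ → χ ⟪ 𝔽ₚ.1# ⟫ ℂ.≈ ℂ.1#
  ⟪1⟫ χ = ℂ.trans (⟪unit⟫ χ (AbelianGroup.ε 𝔽ₚ.unitGroup)) (GroupHomomorphism.ε-homo χ)

  ⟪*⟫ : ∀ χ x y → χ ⟪ x 𝔽ₚ.* y ⟫ ℂ.≈ χ ⟪ x ⟫ ℂ.* χ ⟪ y ⟫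
  ⟪*⟫ χ x y = go (x Fin.≟ 𝔽ₚ.0#) (y Fin.≟ 𝔽ₚ.0#)
    where
    go : Dec (x ≡ 𝔽ₚ.0#) → Dec (y ≡ 𝔽ₚ.0#) → χ ⟪ x 𝔽ₚ.* y ⟫ ℂ.≈ χ ⟪ x ⟫ ℂ.* χ ⟪ y ⟫
    go (yes x≡0) _ = begin
      χ ⟪ x 𝔽ₚ.* y ⟫              ≈⟨ ⟪0⟫ χ (≡.trans (≡.cong (𝔽ₚ._* y) x≡0) (𝔽ₚ.zeroˡ y)) ⟩
      ℂ.0#                        ≈⟨ ℂ.zeroˡ (χ ⟪ y ⟫) ⟨
      ℂ.0# ℂ.* χ ⟪ y ⟫            ≈⟨ ℂ.*-congʳ (⟪0⟫ χ x≡0) ⟨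
      χ ⟪ x ⟫ ℂ.* χ ⟪ y ⟫         ∎
    go (no _) (yes y≡0) = begin
      χ ⟪ x 𝔽ₚ.* y ⟫              ≈⟨ ⟪0⟫ χ (≡.trans (≡.cong (x 𝔽ₚ.*_) y≡0) (𝔽ₚ.zeroʳ x)) ⟩
      ℂ.0#                        ≈⟨ ℂ.zeroʳ (χ ⟪ x ⟫) ⟨
      χ ⟪ x ⟫ ℂ.* ℂ.0#            ≈⟨ ℂ.*-congˡ (⟪0⟫ χ y≡0) ⟨
      χ ⟪ x ⟫ ℂ.* χ ⟪ y ⟫         ∎
    go (no x≢0) (no y≢0) = begin
      χ ⟪ x 𝔽ₚ.* y ⟫                                ≈⟨ ⟪unit⟫ χ (asUnit x≢0 ⊙ asUnit y≢0) ⟩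
      value χ (asUnit x≢0 ⊙ asUnit y≢0)             ≈⟨ GroupHomomorphism.homo χ (asUnit x≢0) (asUnit y≢0) ⟩
      value χ (asUnit x≢0) ℂ.* value χ (asUnit y≢0) ≈⟨ ℂ.*-cong (⟪unit⟫ χ (asUnit x≢0)) (⟪unit⟫ χ (asUnit y≢0)) ⟨
      χ ⟪ x ⟫ ℂ.* χ ⟪ y ⟫                           ∎
      where open AbelianGroup 𝔽ₚ.unitGroup using () renaming (_∙_ to _⊙_)

  ⟪unit*⟫ : ∀ χ u x → χ ⟪ 𝔽ₚ.val u 𝔽ₚ.* x ⟫ ℂ.≈ value χ u ℂ.* χ ⟪ x ⟫
  ⟪unit*⟫ χ u x = ℂ.trans (⟪*⟫ χ (𝔽ₚ.val u) x) (ℂ.*-congʳ (⟪unit⟫ χ u))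

  ⟪^⟫ : ∀ χ x n → χ ⟪ x 𝔽ₚ.^ n ⟫ ℂ.≈ χ ⟪ x ⟫ ℂ.^ n
  ⟪^⟫ χ x zero    = ⟪1⟫ χ
  ⟪^⟫ χ x (suc n) = begin
    χ ⟪ x 𝔽ₚ.* x 𝔽ₚ.^ n ⟫           ≈⟨ ⟪*⟫ χ x (x 𝔽ₚ.^ n) ⟩
    χ ⟪ x ⟫ ℂ.* χ ⟪ x 𝔽ₚ.^ n ⟫      ≈⟨ ℂ.*-congˡ {χ ⟪ x ⟫} {χ ⟪ x 𝔽ₚ.^ n ⟫} {χ ⟪ x ⟫ ℂ.^ n} (⟪^⟫ χ x n) ⟩
    χ ⟪ x ⟫ ℂ.* χ ⟪ x ⟫ ℂ.^ n       ∎

  ⟪product⟫ : ∀ χ {n} (f : Fin n → Fin p) → χ ⟪ 𝔽ₚ.product f ⟫ ℂ.≈ ℂ.product (λ r → χ ⟪ f r ⟫)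
  ⟪product⟫ χ {zero}  f = ⟪1⟫ χ
  ⟪product⟫ χ {suc n} f = begin
    χ ⟪ f zero 𝔽ₚ.* 𝔽ₚ.product (f ∘ suc) ⟫                ≈⟨ ⟪*⟫ χ (f zero) (𝔽ₚ.product (f ∘ suc)) ⟩
    χ ⟪ f zero ⟫ ℂ.* χ ⟪ 𝔽ₚ.product (f ∘ suc) ⟫           ≈⟨ ℂ.*-congˡ {χ ⟪ f zero ⟫} (⟪product⟫ χ (f ∘ suc)) ⟩
    χ ⟪ f zero ⟫ ℂ.* ℂ.product (λ r → χ ⟪ f (suc r) ⟫)    ∎

  value-^ : ∀ χ n u → value (χ ^ (+ n)) u ℂ.≈ value χ u ℂ.^ n
  value-^ χ n u = multiplicative⇒^ (characterGroup p-prime) (λ ψ → value ψ u) ℂ.refl (λ _ _ → ℂ.refl) χ n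

  -- The exponent must be positive: at x = 0 the trivial character is 0, whereas 0 ^ 0 = 1.
  value⇒⟪⟫ : ∀ χ ψ {n} → 0 ℕ.< n → (∀ u → value ψ u ℂ.≈ value χ u ℂ.^ n) →
             ∀ x → ψ ⟪ x ⟫ ℂ.≈ χ ⟪ x ⟫ ℂ.^ n
  value⇒⟪⟫ χ ψ {n@(suc n-1)} _ eq x = go (x Fin.≟ 𝔽ₚ.0#)
    where
    go : Dec (x ≡ 𝔽ₚ.0#) → ψ ⟪ x ⟫ ℂ.≈ χ ⟪ x ⟫ ℂ.^ n
    go (yes x≡0) = begin
      ψ ⟪ x ⟫                             ≈⟨ ⟪0⟫ ψ x≡0 ⟩
      ℂ.0#                                ≈⟨ ℂ.zeroˡ (χ ⟪ x ⟫ ℂ.^ n-1) ⟨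
      ℂ.0# ℂ.* χ ⟪ x ⟫ ℂ.^ n-1            ≈⟨ ℂ.*-congʳ (⟪0⟫ χ x≡0) ⟨
      χ ⟪ x ⟫ ℂ.^ n                       ∎
    go (no x≢0) = begin
      ψ ⟪ x ⟫                     ≈⟨ ⟪unit⟫ ψ (asUnit x≢0) ⟩
      value ψ (asUnit x≢0)        ≈⟨ eq (asUnit x≢0) ⟩
      value χ (asUnit x≢0) ℂ.^ n  ≈⟨ ℂᵖ.^-congˡ n (⟪unit⟫ χ (asUnit x≢0)) ⟨
      χ ⟪ x ⟫ ℂ.^ n               ∎

  value-quotient : ∀ χ ψ u {z} → value χ u ℂ.≈ value ψ u ℂ.* z → value (χ ∙ ψ ⁻¹) u ℂ.≈ z
  value-quotient χ ψ u {z} χ≈ψz = begin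
    value χ u ℂ.* w⁻¹           ≈⟨ ℂ.*-congʳ {w⁻¹} χ≈ψz ⟩
    value ψ u ℂ.* z ℂ.* w⁻¹     ≈⟨ xy∙z≈xz∙y (value ψ u) z w⁻¹ ⟩
    value ψ u ℂ.* w⁻¹ ℂ.* z     ≈⟨ ℂ.*-congʳ {z} (ℂˣ.inverse (GroupHomomorphism.⟦_⟧ ψ u)) ⟩
    ℂ.1# ℂ.* z                  ≈⟨ ℂ.*-identityˡ z ⟩
    z                           ∎
    where
    open CommutativeSemigroupProperties ℂ.*-commutativeSemigroup using (xy∙z≈xz∙y)
    w⁻¹ = ℂˣ.inv (GroupHomomorphism.⟦_⟧ ψ u)

  value-^-⁻¹ : ∀ χ {n} → 0 ℕ.< n → ∀ u → value ((χ ^ (- (+ n))) ⁻¹) u ℂ.≈ value χ u ℂ.^ n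
  value-^-⁻¹ χ {suc n} _ u = ℂ.trans
    (involutive⇒^-⁻¹ (characterGroup p-prime) (λ ψ → value ψ u) (λ _ → ℂ.refl) χ n)
    (value-^ χ (suc n) u)

  -- Orthogonality of characters

  multiplication : 𝔽ₚ.Unit → Permutation p p
  multiplication (𝔽ₚ.unit a b ab≡1) = permutation (a 𝔽ₚ.*_) (b 𝔽ₚ.*_)
    (cancel a b ab≡1) (cancel b a (≡.trans (𝔽ₚ.*-comm b a) ab≡1))
    where
    cancel : ∀ a b → a 𝔽ₚ.* b ≡ 𝔽ₚ.1# → ∀ x → a 𝔽ₚ.* (b 𝔽ₚ.* x) ≡ x
    cancel a b ab≡1 x = ≡.trans (≡.sym (𝔽ₚ.*-assoc a b x))
      (≡.trans (≡.cong (𝔽ₚ._* x) ab≡1) (𝔽ₚ.*-identityˡ x))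

  -- Replacing a by u a permutes 𝔽ₚ and multiplies every term by χ(u)^n.
  sum-invariant : ∀ χ n u → value χ u ℂ.^ n ℂ.* ℂ.sum (λ a → χ ⟪ a ⟫ ℂ.^ n) ℂ.≈ ℂ.sum (λ a → χ ⟪ a ⟫ ℂ.^ n)
  sum-invariant χ n u = begin
    value χ u ℂ.^ n ℂ.* ℂ.sum (λ a → χ ⟪ a ⟫ ℂ.^ n)
      ≈⟨ ℂᵖ.*-distribˡ-sum (value χ u ℂ.^ n) (λ a → χ ⟪ a ⟫ ℂ.^ n) ⟩
    ℂ.sum (λ a → value χ u ℂ.^ n ℂ.* χ ⟪ a ⟫ ℂ.^ n)
      ≈⟨ ℂᵖ.sum-cong-≋ (λ a → ^-distrib-* (value χ u) (χ ⟪ a ⟫) n) ⟨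
    ℂ.sum (λ a → (value χ u ℂ.* χ ⟪ a ⟫) ℂ.^ n)             ≈⟨ ℂᵖ.sum-cong-≋ (λ a → ℂᵖ.^-congˡ n (⟪unit*⟫ χ u a)) ⟨
    ℂ.sum (λ a → χ ⟪ 𝔽ₚ.val u 𝔽ₚ.* a ⟫ ℂ.^ n)
      ≈⟨ ℂᵖ.sum-permute (λ a → χ ⟪ a ⟫ ℂ.^ n) (multiplication u) ⟨
    ℂ.sum (λ a → χ ⟪ a ⟫ ℂ.^ n)                             ∎

  -- No u with χ(u)^n ≠ 1 has to be exhibited: if the sum were nonzero, its invariance would force
  -- χ(u)^n = 1 for every u, making χ^n trivial. Stability of equality is used for the sum and for
  -- each value.
  orthogonality : ∀ χ n → ¬ (χ ^ (+ n)) ≋ ε → ℂ.sum (λ a → χ ⟪ a ⟫ ℂ.^ n) ℂ.≈ ℂ.0#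
  orthogonality χ n χ^n≉ε = ℂᵖ.≈-stable _ _ λ sum≉0 → χ^n≉ε λ u →
    ℂ.trans (value-^ χ n u) (ℂᵖ.≈-stable _ _ λ ≉1 →
      sum≉0 (ℂᵖ.xy≈y⇒y≈0 _ _ (sum-invariant χ n u) ≉1))

  -- Points of the curve and N-th roots

  #curve≡1+sum : ∀ {n} (N i j : ℕ) (k : Vector ℕ n) (λs : Vector (Fin p) n) →
    #PicardCurve p-prime N i j k λs ≡
    suc (ℂᵖ.Nat.sum λ x → 𝔽ₚ.#roots N (picardPolynomial p-prime i j k λs x))
  #curve≡1+sum N i j k λs = ≡.cong suc (length-filter-cartesianProduct
    (λ (x , y) → y 𝔽ₚ.^ N Fin.≟ picardPolynomial p-prime i j k λs x) (λ x → x) (allFin p))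

  module _ {N-1 : ℕ} (η : Character p-prime) (η-order : HasOrder η (suc N-1)) where

    private
      N = suc N-1

    sum-geometric : ℂ.sum (λ a → ℂᵖ.geometric N (η ⟪ a ⟫)) ℂ.≈ ℂ.fromℕ p
    sum-geometric = begin
      ℂ.sum (λ a → ℂᵖ.geometric N (η ⟪ a ⟫))                     ≈⟨ ℂᵖ.∑-comm {p} {N} (λ a m → η ⟪ a ⟫ ℂ.^ toℕ m) ⟩
      -- The exponent 0 gives p, because z^0 = 1 also at a = 0. For 0 < m < N, minimality of the
      -- order of η makes η^m nontrivial.
      ℂ.sum {N} (λ m → ℂ.sum {p} (λ a → η ⟪ a ⟫ ℂ.^ toℕ m))      ≈⟨ ℂ.+-cong (ℂᵖ.sum-replicate p)
        (ℂᵖ.sum-cong-≋ (λ m → orthogonality η (suc (toℕ m))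
          (proj₂ (proj₂ η-order) (suc (toℕ m)) (ℕ.s≤s ℕ.z≤n) (ℕ.s≤s (Fin.toℕ<n m))))) ⟩
      ℂ.fromℕ p ℂ.+ ℂ.sum {N-1} (λ _ → ℂ.0#)                     ≈⟨ ℂ.+-congˡ (ℂᵖ.sum-replicate-zero N-1) ⟩
      ℂ.fromℕ p ℂ.+ ℂ.0#                                         ≈⟨ ℂ.+-identityʳ _ ⟩
      ℂ.fromℕ p                                                  ∎

    η^N≈1 : ∀ {x} → x ≢ 𝔽ₚ.0# → η ⟪ x ⟫ ℂ.^ N ℂ.≈ ℂ.1#
    η^N≈1 {x} x≢0 = begin
      η ⟪ x ⟫ ℂ.^ N                 ≈⟨ ℂᵖ.^-congˡ N (⟪unit⟫ η (asUnit x≢0)) ⟩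
      value η (asUnit x≢0) ℂ.^ N    ≈⟨ value-^ η N (asUnit x≢0) ⟨
      value (η ^ (+ N)) (asUnit x≢0) ≈⟨ proj₁ (proj₂ η-order) (asUnit x≢0) ⟩
      ℂ.1#                          ∎

    nonPower : ∀ {a} → a ≢ 𝔽ₚ.0# → ¬ η ⟪ a ⟫ ℂ.≈ ℂ.1# → ∀ y → y 𝔽ₚ.^ N ≢ a
    nonPower a≢0 ηa≉1 y ≡.refl = ηa≉1 (ℂ.trans (⟪^⟫ η y N) (η^N≈1 y≢0))
      where
      y≢0 : y ≢ 𝔽ₚ.0#
      y≢0 ≡.refl = a≢0 (𝔽ₚ.0^1+n≡0 N-1)

    -- The geometric sum is a complex number, so the inequality is stated through a natural number s
    -- representing it: 1 at a = 0, otherwise N or 0. The double negation pays for the case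
    -- distinction on η(a) = 1.
    #roots≤geometric : ∀ a → ¬ ¬ ∃ λ s → ℂ.fromℕ s ℂ.≈ ℂᵖ.geometric N (η ⟪ a ⟫) × 𝔽ₚ.#roots N a ℕ.≤ s
    #roots≤geometric a = go (a Fin.≟ 𝔽ₚ.0#)
      where
      go : Dec (a ≡ 𝔽ₚ.0#) → ¬ ¬ ∃ λ s → ℂ.fromℕ s ℂ.≈ ℂᵖ.geometric N (η ⟪ a ⟫) × 𝔽ₚ.#roots N a ℕ.≤ s
      go (yes ≡.refl) ¬∃ = ¬∃ (1 ,
        ℂ.trans (ℂ.+-identityʳ ℂ.1#) (ℂ.sym (ℂ.trans (ℂᵖ.geometric-cong N (⟪0⟫ η ≡.refl)) (ℂᵖ.geometric-0 N-1))) ,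
        𝔽ₚ.#roots-0≤1 N)
      go (no a≢0) = ¬¬-map (λ where
        (yes ηa≈1) → N ,
          ℂ.sym (ℂ.trans (ℂᵖ.geometric-cong N ηa≈1) (ℂᵖ.geometric-1 N)) ,
          𝔽ₚ.#roots≤N N-1 a
        (no ηa≉1) → 0 ,
          ℂ.sym (ℂᵖ.geometric-root N (η ⟪ a ⟫) (η^N≈1 a≢0) ηa≉1) ,
          ℕ.≤-reflexive (𝔽ₚ.#roots≡0 N a (nonPower a≢0 ηa≉1)))
        ¬¬-excluded-middle

    #roots≈geometric : ∀ a → ℂ.fromℕ (𝔽ₚ.#roots N a) ℂ.≈ ℂᵖ.geometric N (η ⟪ a ⟫)
    #roots≈geometric a = ℂᵖ.≈-stable _ _ (¬¬-map conclude
      -- As 𝔽ₚ is finite, the double negations for all a combine into one, which the stable goal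
      -- absorbs.
      (Fin.sequence (RawMonad.rawApplicative ¬¬-Monad) #roots≤geometric))
      where
      conclude : (∀ a → ∃ λ s → ℂ.fromℕ s ℂ.≈ ℂᵖ.geometric N (η ⟪ a ⟫) × 𝔽ₚ.#roots N a ℕ.≤ s) →
                 ℂ.fromℕ (𝔽ₚ.#roots N a) ℂ.≈ ℂᵖ.geometric N (η ⟪ a ⟫)
      conclude bound = ℂ.trans (ℂ.reflexive (≡.cong ℂ.fromℕ
          (sum-≡⇒≗ (𝔽ₚ.#roots N) s (proj₂ ∘ proj₂ ∘ bound) (≡.trans (sum-fibres (𝔽ₚ._^ N)) (≡.sym sum-s≡p)) a)))
        (proj₁ (proj₂ (bound a)))
        where
        s : Fin p → ℕ
        s = proj₁ ∘ bound
        sum-s≡p : ℂᵖ.Nat.sum s ≡ p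
        sum-s≡p = ℂᵖ.fromℕ-injective _ _ (ℂ.trans (ℂᵖ.fromℕ-sum s)
          (ℂ.trans (ℂᵖ.sum-cong-≋ (proj₁ ∘ proj₂ ∘ bound)) sum-geometric))

    #curve≈sum : ∀ {n} (i j : ℕ) (k : Vector ℕ n) (λs : Vector (Fin p) n) →
      ℂ.fromℕ (#PicardCurve p-prime N i j k λs) ℂ.≈
      ℂ.1# ℂ.+ ℂ.fromℕ p ℂ.+
      ℂ.sum₁ N-1 λ m → ℂ.sum λ x → η ⟪ picardPolynomial p-prime i j k λs x ⟫ ℂ.^ m
    #curve≈sum i j k λs = begin
      ℂ.fromℕ (#PicardCurve p-prime N i j k λs)
        ≡⟨ ≡.cong ℂ.fromℕ (#curve≡1+sum N i j k λs) ⟩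
      ℂ.1# ℂ.+ ℂ.fromℕ (ℂᵖ.Nat.sum (λ x → 𝔽ₚ.#roots N (f x)))
        ≈⟨ ℂ.+-congˡ (ℂᵖ.fromℕ-sum (λ x → 𝔽ₚ.#roots N (f x))) ⟩
      ℂ.1# ℂ.+ ℂ.sum (λ x → ℂ.fromℕ (𝔽ₚ.#roots N (f x)))
        ≈⟨ ℂ.+-congˡ (ℂᵖ.sum-cong-≋ (λ x → #roots≈geometric (f x))) ⟩
      -- The exponent 0 splits off definitionally as the inner 1; its sum over x becomes the summand
      -- p.
      ℂ.1# ℂ.+ ℂ.sum (λ x → ℂ.1# ℂ.+ ℂ.sum {N-1} (λ m → g (suc (toℕ m)) x))
        ≈⟨ ℂ.+-congˡ (ℂᵖ.∑-distrib-+ (λ _ → ℂ.1#) (λ x → ℂ.sum {N-1} (λ m → g (suc (toℕ m)) x))) ⟩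
      ℂ.1# ℂ.+ (ℂ.sum {p} (λ _ → ℂ.1#) ℂ.+ ℂ.sum (λ x → ℂ.sum {N-1} (λ m → g (suc (toℕ m)) x)))
        ≈⟨ ℂ.+-congˡ (ℂ.+-cong (ℂᵖ.sum-replicate p) (ℂᵖ.∑-comm {p} {N-1} (λ x m → g (suc (toℕ m)) x))) ⟩
      ℂ.1# ℂ.+ (ℂ.fromℕ p ℂ.+ ℂ.sum₁ N-1 (λ m → ℂ.sum (g m)))
        ≈⟨ ℂ.+-assoc ℂ.1# (ℂ.fromℕ p) _ ⟨
      ℂ.1# ℂ.+ ℂ.fromℕ p ℂ.+ ℂ.sum₁ N-1 (λ m → ℂ.sum (g m)) ∎
      where
      f : Fin p → Fin p
      f = picardPolynomial p-prime i j k λs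
      g : ℕ → Fin p → ℂ
      g m x = η ⟪ f x ⟫ ℂ.^ m

  -- From character sums to period functions

  ⟪^⟫^ : ∀ χ x m n → χ ⟪ x 𝔽ₚ.^ n ⟫ ℂ.^ m ℂ.≈ χ ⟪ x ⟫ ℂ.^ (m ℕ.* n)
  ⟪^⟫^ χ x m n = begin
    χ ⟪ x 𝔽ₚ.^ n ⟫ ℂ.^ m        ≈⟨ ℂᵖ.^-congˡ m (⟪^⟫ χ x n) ⟩
    (χ ⟪ x ⟫ ℂ.^ n) ℂ.^ m       ≈⟨ ℂᵖ.^-assocʳ (χ ⟪ x ⟫) n m ⟩
    χ ⟪ x ⟫ ℂ.^ (n ℕ.* m)       ≡⟨ ≡.cong (χ ⟪ x ⟫ ℂ.^_) (ℕ.*-comm n m) ⟩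
    χ ⟪ x ⟫ ℂ.^ (m ℕ.* n)       ∎

  -- Multiplicativity splits χ(f(x))^m over the linear factors of f. `A`, `D` and `E` stand for the
  -- characters A, C/A and 1/B of the period, known only by their values on units; positive
  -- exponents make the two sides agree at zeros of the factors as well.
  sum≈periods : ∀ χ {n} (A D : Character p-prime) (E : Vector (Character p-prime) n)
    {i j : ℕ} {k : Vector ℕ n} (λs : Vector (Fin p) n) m →
    0 ℕ.< m ℕ.* i → 0 ℕ.< m ℕ.* j → (∀ r → 0 ℕ.< m ℕ.* k r) →
    (∀ u → value A u ℂ.≈ value χ u ℂ.^ (m ℕ.* i)) →
    (∀ u → value D u ℂ.≈ value χ u ℂ.^ (m ℕ.* j)) →
    (∀ r u → value (E r) u ℂ.≈ value χ u ℂ.^ (m ℕ.* k r)) →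
    ℂ.sum (λ x → χ ⟪ picardPolynomial p-prime i j k λs x ⟫ ℂ.^ m) ℂ.≈
    ℂ.sum (λ x → A ⟪ x ⟫ ℂ.* D ⟪ 𝔽ₚ.1# 𝔽ₚ.- x ⟫ ℂ.* ℂ.product (λ r → E r ⟪ 𝔽ₚ.1# 𝔽ₚ.- λs r 𝔽ₚ.* x ⟫))
  sum≈periods χ A D E {i} {j} {k} λs m 0<mi 0<mj 0<mk A≈ D≈ E≈ = ℂᵖ.sum-cong-≋ λ x →
    let a = x 𝔽ₚ.^ i
        b = (𝔽ₚ.1# 𝔽ₚ.- x) 𝔽ₚ.^ j
        c = λ r → (𝔽ₚ.1# 𝔽ₚ.- λs r 𝔽ₚ.* x) 𝔽ₚ.^ k r
    in begin
    χ ⟪ a 𝔽ₚ.* b 𝔽ₚ.* 𝔽ₚ.product c ⟫ ℂ.^ m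
      ≈⟨ ℂᵖ.^-congˡ m (ℂ.trans (⟪*⟫ χ (a 𝔽ₚ.* b) (𝔽ₚ.product c)) (ℂ.*-cong (⟪*⟫ χ a b) (⟪product⟫ χ c))) ⟩
    (χ ⟪ a ⟫ ℂ.* χ ⟪ b ⟫ ℂ.* ℂ.product (λ r → χ ⟪ c r ⟫)) ℂ.^ m
      ≈⟨ ^-distrib-* (χ ⟪ a ⟫ ℂ.* χ ⟪ b ⟫) (ℂ.product (λ r → χ ⟪ c r ⟫)) m ⟩
    (χ ⟪ a ⟫ ℂ.* χ ⟪ b ⟫) ℂ.^ m ℂ.* ℂ.product (λ r → χ ⟪ c r ⟫) ℂ.^ m
      ≈⟨ ℂ.*-cong (^-distrib-* (χ ⟪ a ⟫) (χ ⟪ b ⟫) m) (ℂᵖ.product-^ (λ r → χ ⟪ c r ⟫) m) ⟩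
    χ ⟪ a ⟫ ℂ.^ m ℂ.* χ ⟪ b ⟫ ℂ.^ m ℂ.* ℂ.product (λ r → χ ⟪ c r ⟫ ℂ.^ m)
      ≈⟨ ℂ.*-cong (ℂ.*-cong (⟪^⟫^ χ x m i) (⟪^⟫^ χ (𝔽ₚ.1# 𝔽ₚ.- x) m j))
                  (ℂᵖ.product-cong (λ r → ⟪^⟫^ χ (𝔽ₚ.1# 𝔽ₚ.- λs r 𝔽ₚ.* x) m (k r))) ⟩
    χ ⟪ x ⟫ ℂ.^ (m ℕ.* i) ℂ.* χ ⟪ 𝔽ₚ.1# 𝔽ₚ.- x ⟫ ℂ.^ (m ℕ.* j) ℂ.*
    ℂ.product (λ r → χ ⟪ 𝔽ₚ.1# 𝔽ₚ.- λs r 𝔽ₚ.* x ⟫ ℂ.^ (m ℕ.* k r))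
      ≈⟨ ℂ.*-cong (ℂ.*-cong (value⇒⟪⟫ χ A 0<mi A≈ x) (value⇒⟪⟫ χ D 0<mj D≈ (𝔽ₚ.1# 𝔽ₚ.- x)))
                  (ℂᵖ.product-cong (λ r → value⇒⟪⟫ χ (E r) (0<mk r) (E≈ r) (𝔽ₚ.1# 𝔽ₚ.- λs r 𝔽ₚ.* x))) ⟨
    A ⟪ x ⟫ ℂ.* D ⟪ 𝔽ₚ.1# 𝔽ₚ.- x ⟫ ℂ.* ℂ.product (λ r → E r ⟪ 𝔽ₚ.1# 𝔽ₚ.- λs r 𝔽ₚ.* x ⟫) ∎

  -- For the second factor of the period: C/A with C = η^(mi+mj) and A = η^(mi) is η^(mj) on units.
  value-^-quotient : ∀ χ m n u → value ((χ ^ (+ (m ℕ.+ n))) ∙ (χ ^ (+ m)) ⁻¹) u ℂ.≈ value χ u ℂ.^ n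
  value-^-quotient χ m n u = value-quotient (χ ^ (+ (m ℕ.+ n))) (χ ^ (+ m)) u (begin
    value (χ ^ (+ (m ℕ.+ n))) u               ≈⟨ value-^ χ (m ℕ.+ n) u ⟩
    value χ u ℂ.^ (m ℕ.+ n)                   ≈⟨ ℂᵖ.^-homo-* (value χ u) m n ⟩
    value χ u ℂ.^ m ℂ.* value χ u ℂ.^ n       ≈⟨ ℂ.*-congʳ {value χ u ℂ.^ n} (value-^ χ m u) ⟨
    value (χ ^ (+ m)) u ℂ.* value χ u ℂ.^ n   ∎)

-- The point count as a sum of Appell-Lauricella periods

open import Data.Nat.Base using (_+_; _*_; _∸_; _≤_; _<_)
open import Data.Nat.Divisibility using (_∣_; _∤_)
open import Data.Nat.GCD using (gcd)
open import Data.Vec.Functional using (foldr)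
open import Function.Definitions using (Injective)

theorem5p3 : (n : ℕ) → 2 ≤ n →
    (N i j : ℕ) (k : Vector ℕ n) →
    0 < N → 0 < i → 0 < j → (∀ r → 0 < k r) →
    gcd N (gcd i (gcd j (foldr gcd 0 k))) ≡ 1 →
    N ∤ i + j + foldr _+_ 0 k →
    (p : ℕ) (p-prime : Prime p) → N ∣ p ∸ 1 →
    (λs : Vector (Fin p) n) →
    Injective _≡_ _≡_ λs →
    (∀ r → λs r ≢ 𝔽.0# p-prime) →
    (∀ r → λs r ≢ 𝔽.1# p-prime) →
    let open Powers (AbelianGroup.group (characterGroup p-prime)) in
    (η : Character p-prime) → HasOrder η N →
    ℂ.fromℕ (#PicardCurve p-prime N i j k λs) ℂ.≈
    ℂ.1# ℂ.+ ℂ.fromℕ p ℂ.+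
    ℂ.sum₁ (N ∸ 1) λ m →
    ℙD p-prime (η ^ (+ (m * i)))
    (λ r → η ^ (- (+ (m * k r))))
    (η ^ (+ (m * i + m * j)))
    λs
theorem5p3 n _ (suc N-1) i j k _ 0<i 0<j 0<k _ _ p p-prime _ λs _ _ _ η η-order =
  ℂ.trans (#curve≈sum η η-order i j k λs) (ℂ.+-congˡ (ℂᵖ.sum-cong-≋ {N-1} λ m →
    -- The characters are read off the goal: comparing them with ones written out here would unfold ℙD.
    sum≈periods η _ _ _ {i} {j} {k} λs (suc (toℕ m)) (pos m 0<i) (pos m 0<j) (λ r → pos m (0<k r))
      (value-^ η (suc (toℕ m) * i))
      (value-^-quotient η (suc (toℕ m) * i) (suc (toℕ m) * j))
      (λ r → value-^-⁻¹ η (pos m (0<k r)))))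
  where
  open Characters p-prime
  -- `sum₁` shifts the index by one, so the exponents are multiples of 1 + m and are positive, as
  -- the extension by 0 demands.
  pos : ∀ (m : Fin N-1) {n} → 0 < n → 0 < suc (toℕ m) * n
  pos m 0<n = ℕ.*-mono-< {0} {suc (toℕ m)} (ℕ.s≤s ℕ.z≤n) 0<n
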